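{- Let $k\ge 0$ and $\delta\ge k+2$ be integers, and let $n$ be sufficiently large (i.e. $n\ge n_0(k,\delta)$ for some $n_0$ depending only on $k$ and $\delta$). If $G$ is an $n$-vertex graph with minimum degree $\delta(G)\ge\delta$ and $$\lambda(G)\ge n-\delta+k-1,$$ then $G$ is $k$-Hamiltonian unless $G=H_{n,k,\delta}$ or $G=L_{n,k,\delta}$.
   Context: All graphs are finite and simple; equality of graphs means isomorphism. $\lambda(G)$ denotes the spectral radius of $G$, i.e. the largest eigenvalue of the adjacency matrix $A(G)$. $K_s$ is the complete graph on $s$ vertices, $I_t$ is the edgeless graph on $t$ vertices, $G\cup H$ is the disjoint union, and $G\vee H$ is the join (obtained from $G\cup H$ by adding all edges between $G$ and $H$). A graph is Hamiltonian if it has a Hamilton cycle (a cycle through all vertices). A graph $G=(V,E)$ is $k$-Hamiltonian if for all $X\subseteq V$ with $|X|\le k$, the subgraph induced by $V\setminus X$ is Hamiltonian. Define $$H_{n,k,\delta}:=K_\delta\vee(K_{n-2\delta+k}\cup I_{\delta-k}),\qquad L_{n,k,\delta}:=K_{k+1}\vee(K_{n-\delta-1}\cup K_{\delta-k}).$$ -}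

module Defs where

open import Data.Bool.Base using (Bool; true; false; not; if_then_else_)
open import Data.Fin.Base using (Fin; toℕ)
open import Data.Fin.Properties using () renaming (_≟_ to _≟ᶠ_)
open import Data.Fin.Subset using (Subset; ∣_∣; _∉_)
open import Data.Integer.Base as ℤ using (ℤ)
open import Data.List.Base using (map; allFin)
open import Data.List.Extrema.Nat using (min)
open import Data.Nat.Base as ℕ using (ℕ; suc; _⊔_)
import Data.Nat.Properties as ℕ
open import Data.Nat.DivMod using (_mod_)
open import Data.Product.Base using (Σ; Σ-syntax; ∃; ∃-syntax; _×_; _,_; proj₁; proj₂)
open import Data.Rational.Base as ℚ using (ℚ; 0ℚ; 1ℚ)
import Data.Rational.Properties as ℚ
open import Data.Rational.Solver using (module +-*-Solver)
open import Data.Sum.Base using (_⊎_; inj₁; inj₂)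
open import Data.Vec.Base using (tabulate)
open import Data.Vec.Functional using (Vector; foldr)
open import Function.Bundles using (_↔_; module Inverse)
open import Relation.Binary.PropositionalEquality
  using (_≡_; refl; sym; trans; cong; subst)
open import Relation.Nullary using (¬_; yes; no; contradiction)
open import Relation.Nullary.Decidable.Core using (⌊_⌋)

------------------------------------------------------------------------
-- Real numbers: Cauchy sequences of rationals, equal when their
-- difference tends to 0.

IsCauchy : (ℕ → ℚ) → Set
IsCauchy x = ∀ ε → 0ℚ ℚ.< ε →
  ∃[ N ] ∀ m n → N ℕ.≤ m → N ℕ.≤ n → ℚ.∣ x m ℚ.- x n ∣ ℚ.< ε

record ℝ : Set where
  constructor mkℝ
  field
    seq      : ℕ → ℚ
    isCauchy : IsCauchy seq

open ℝ public

infix  4 _≈ʳ_ _≤ʳ_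
infixl 6 _+ʳ_
infixl 7 _*ʳ_

_≈ʳ_ : ℝ → ℝ → Set
x ≈ʳ y = ∀ ε → 0ℚ ℚ.< ε →
  ∃[ N ] ∀ n → N ℕ.≤ n → ℚ.∣ seq x n ℚ.- seq y n ∣ ℚ.< ε

-- The slack ε is needed: representatives of equal reals may be ordered
-- either way termwise.
_≤ʳ_ : ℝ → ℝ → Set
x ≤ʳ y = ∀ ε → 0ℚ ℚ.< ε →
  ∃[ N ] ∀ n → N ℕ.≤ n → seq x n ℚ.< seq y n ℚ.+ ε

halve : ∀ ε → 0ℚ ℚ.< ε → 0ℚ ℚ.< ε ℚ.* ℚ.½
halve ε 0<ε = subst (ℚ._< ε ℚ.* ℚ.½) (ℚ.*-zeroˡ ℚ.½) (ℚ.*-monoˡ-<-pos ℚ.½ 0<ε)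

half+half : ∀ ε → ε ℚ.* ℚ.½ ℚ.+ ε ℚ.* ℚ.½ ≡ ε
half+half ε = trans (sym (ℚ.*-distribˡ-+ ε ℚ.½ ℚ.½)) (ℚ.*-identityʳ ε)

tailBound : ∀ {x} → IsCauchy x →
  ∃[ B ] (0ℚ ℚ.< B × ∃[ N ] ∀ n → N ℕ.≤ n → ℚ.∣ x n ∣ ℚ.≤ B)
tailBound {x} cx with cx 1ℚ (ℚ.positive⁻¹ 1ℚ)
... | N , h = 1ℚ ℚ.+ ℚ.∣ x N ∣ , ℚ.+-mono-<-≤ (ℚ.positive⁻¹ 1ℚ) (ℚ.0≤∣p∣ (x N)) , N , bound
  where
  open ℚ.≤-Reasoning
  open +-*-Solver
  bound : ∀ n → N ℕ.≤ n → ℚ.∣ x n ∣ ℚ.≤ 1ℚ ℚ.+ ℚ.∣ x N ∣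
  bound n N≤n = begin
    ℚ.∣ x n ∣
      ≡⟨ cong ℚ.∣_∣ (solve 2 (λ a b → a := (a :- b) :+ b) refl (x n) (x N)) ⟩
    ℚ.∣ (x n ℚ.- x N) ℚ.+ x N ∣
      ≤⟨ ℚ.∣p+q∣≤∣p∣+∣q∣ (x n ℚ.- x N) (x N) ⟩
    ℚ.∣ x n ℚ.- x N ∣ ℚ.+ ℚ.∣ x N ∣
      ≤⟨ ℚ.+-monoˡ-≤ ℚ.∣ x N ∣ (ℚ.<⇒≤ (h n N N≤n ℕ.≤-refl)) ⟩
    1ℚ ℚ.+ ℚ.∣ x N ∣ ∎

isCauchy-const : ∀ q → IsCauchy (λ _ → q)
isCauchy-const q ε 0<ε = 0 , λ _ _ _ _ →
  subst (ℚ._< ε) (sym (cong ℚ.∣_∣ (ℚ.+-inverseʳ q))) 0<ε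

isCauchy-+ : ∀ {x y} → IsCauchy x → IsCauchy y → IsCauchy (λ n → x n ℚ.+ y n)
isCauchy-+ {x} {y} cx cy ε 0<ε
  with cx (ε ℚ.* ℚ.½) (halve ε 0<ε) | cy (ε ℚ.* ℚ.½) (halve ε 0<ε)
... | M , hx | N , hy = M ⊔ N , λ m n M⊔N≤m M⊔N≤n → begin-strict
    ℚ.∣ (x m ℚ.+ y m) ℚ.- (x n ℚ.+ y n) ∣
      ≡⟨ cong ℚ.∣_∣ (solve 4 (λ a b c d → (a :+ b) :- (c :+ d) := (a :- c) :+ (b :- d))
                       refl (x m) (y m) (x n) (y n)) ⟩
    ℚ.∣ (x m ℚ.- x n) ℚ.+ (y m ℚ.- y n) ∣
      ≤⟨ ℚ.∣p+q∣≤∣p∣+∣q∣ (x m ℚ.- x n) (y m ℚ.- y n) ⟩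
    ℚ.∣ x m ℚ.- x n ∣ ℚ.+ ℚ.∣ y m ℚ.- y n ∣
      <⟨ ℚ.+-mono-< (hx m n (ℕ.m⊔n≤o⇒m≤o M N M⊔N≤m) (ℕ.m⊔n≤o⇒m≤o M N M⊔N≤n))
                    (hy m n (ℕ.m⊔n≤o⇒n≤o M N M⊔N≤m) (ℕ.m⊔n≤o⇒n≤o M N M⊔N≤n)) ⟩
    ε ℚ.* ℚ.½ ℚ.+ ε ℚ.* ℚ.½
      ≡⟨ half+half ε ⟩
    ε ∎
  where
  open ℚ.≤-Reasoning
  open +-*-Solver

-- The witness is ε / B.
scale : ∀ B ε → 0ℚ ℚ.< B → 0ℚ ℚ.< ε →
  ∃[ δ ] (0ℚ ℚ.< δ × ∀ a b → ℚ.∣ a ∣ ℚ.≤ B → ℚ.∣ b ∣ ℚ.< δ → ℚ.∣ a ℚ.* b ∣ ℚ.< ε)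
scale B ε 0<B 0<ε = δ , 0<δ , small
  where
  open ℚ.≤-Reasoning
  instance
    B⁺ : ℚ.Positive B
    B⁺ = ℚ.positive 0<B
    B≢0 : ℚ.NonZero B
    B≢0 = ℚ.pos⇒nonZero B
    1/B⁺ : ℚ.Positive (ℚ.1/ B)
    1/B⁺ = ℚ.1/pos⇒pos B
  δ : ℚ
  δ = ε ℚ.* ℚ.1/ B
  0<δ : 0ℚ ℚ.< δ
  0<δ = subst (ℚ._< δ) (ℚ.*-zeroˡ (ℚ.1/ B)) (ℚ.*-monoˡ-<-pos (ℚ.1/ B) 0<ε)
  small : ∀ a b → ℚ.∣ a ∣ ℚ.≤ B → ℚ.∣ b ∣ ℚ.< δ → ℚ.∣ a ℚ.* b ∣ ℚ.< ε
  small a b a≤B b<δ = begin-strict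
    ℚ.∣ a ℚ.* b ∣        ≡⟨ ℚ.∣p*q∣≡∣p∣*∣q∣ a b ⟩
    ℚ.∣ a ∣ ℚ.* ℚ.∣ b ∣  ≤⟨ ℚ.*-monoʳ-≤-nonNeg ℚ.∣ b ∣ {{ℚ.nonNegative (ℚ.0≤∣p∣ b)}} a≤B ⟩
    B ℚ.* ℚ.∣ b ∣        <⟨ ℚ.*-monoʳ-<-pos B b<δ ⟩
    B ℚ.* (ε ℚ.* ℚ.1/ B) ≡⟨ ℚ.*-comm B _ ⟩
    ε ℚ.* ℚ.1/ B ℚ.* B   ≡⟨ ℚ.*-assoc ε (ℚ.1/ B) B ⟩
    ε ℚ.* (ℚ.1/ B ℚ.* B) ≡⟨ cong (ε ℚ.*_) (ℚ.*-inverseˡ B) ⟩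
    ε ℚ.* 1ℚ             ≡⟨ ℚ.*-identityʳ ε ⟩
    ε ∎

isCauchy-* : ∀ {x y} → IsCauchy x → IsCauchy y → IsCauchy (λ n → x n ℚ.* y n)
isCauchy-* {x} {y} cx cy ε 0<ε =
  let B , 0<B , Nx , bx = tailBound cx
      C , 0<C , Ny , by = tailBound cy
      δ , 0<δ , hδ = scale B (ε ℚ.* ℚ.½) 0<B (halve ε 0<ε)
      η , 0<η , hη = scale C (ε ℚ.* ℚ.½) 0<C (halve ε 0<ε)
      My , hy = cy δ 0<δ
      Mx , hx = cx η 0<η
      N = (Nx ⊔ Ny) ⊔ (Mx ⊔ My)
      ≥l : ∀ {i} → N ℕ.≤ i → Nx ⊔ Ny ℕ.≤ i
      ≥l = ℕ.m⊔n≤o⇒m≤o (Nx ⊔ Ny) (Mx ⊔ My)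
      ≥r : ∀ {i} → N ℕ.≤ i → Mx ⊔ My ℕ.≤ i
      ≥r = ℕ.m⊔n≤o⇒n≤o (Nx ⊔ Ny) (Mx ⊔ My)
  in N , λ m n N≤m N≤n → begin-strict
    ℚ.∣ x m ℚ.* y m ℚ.- x n ℚ.* y n ∣
      ≡⟨ cong ℚ.∣_∣ (solve 4 (λ a b c d → a :* b :- c :* d := a :* (b :- d) :+ d :* (a :- c))
                       refl (x m) (y m) (x n) (y n)) ⟩
    ℚ.∣ x m ℚ.* (y m ℚ.- y n) ℚ.+ y n ℚ.* (x m ℚ.- x n) ∣
      ≤⟨ ℚ.∣p+q∣≤∣p∣+∣q∣ (x m ℚ.* (y m ℚ.- y n)) (y n ℚ.* (x m ℚ.- x n)) ⟩
    ℚ.∣ x m ℚ.* (y m ℚ.- y n) ∣ ℚ.+ ℚ.∣ y n ℚ.* (x m ℚ.- x n) ∣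
      <⟨ ℚ.+-mono-<
           (hδ (x m) (y m ℚ.- y n)
             (bx m (ℕ.m⊔n≤o⇒m≤o Nx Ny (≥l N≤m)))
             (hy m n (ℕ.m⊔n≤o⇒n≤o Mx My (≥r N≤m)) (ℕ.m⊔n≤o⇒n≤o Mx My (≥r N≤n))))
           (hη (y n) (x m ℚ.- x n)
             (by n (ℕ.m⊔n≤o⇒n≤o Nx Ny (≥l N≤n)))
             (hx m n (ℕ.m⊔n≤o⇒m≤o Mx My (≥r N≤m)) (ℕ.m⊔n≤o⇒m≤o Mx My (≥r N≤n)))) ⟩
    ε ℚ.* ℚ.½ ℚ.+ ε ℚ.* ℚ.½
      ≡⟨ half+half ε ⟩
    ε ∎
  where
  open ℚ.≤-Reasoning
  open +-*-Solver

fromℚ : ℚ → ℝ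
fromℚ q = mkℝ (λ _ → q) (isCauchy-const q)

fromℤ : ℤ → ℝ
fromℤ i = fromℚ (i ℚ./ 1)

0ʳ 1ʳ : ℝ
0ʳ = fromℚ 0ℚ
1ʳ = fromℚ 1ℚ

_+ʳ_ _*ʳ_ : ℝ → ℝ → ℝ
x +ʳ y = mkℝ (λ n → seq x n ℚ.+ seq y n) (isCauchy-+ {seq x} {seq y} (isCauchy x) (isCauchy y))
x *ʳ y = mkℝ (λ n → seq x n ℚ.* seq y n) (isCauchy-* {seq x} {seq y} (isCauchy x) (isCauchy y))

------------------------------------------------------------------------
-- Eigenvalues of real square matrices

Matrix : ℕ → Set
Matrix n = Fin n → Fin n → ℝ

∑ : ∀ {n} → Vector ℝ n → ℝ
∑ = foldr _+ʳ_ 0ʳ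

_·_ : ∀ {n} → Matrix n → Vector ℝ n → Vector ℝ n
(A · x) i = ∑ λ j → A i j *ʳ x j

IsEigenvalue : ∀ {n} → Matrix n → ℝ → Set
IsEigenvalue {n} A μ = ∃[ x ]
  (¬ (∀ i → x i ≈ʳ 0ʳ)) × (∀ (i : Fin n) → (A · x) i ≈ʳ μ *ʳ x i)

IsLargestEigenvalue : ∀ {n} → Matrix n → ℝ → Set
IsLargestEigenvalue A μ =
  IsEigenvalue A μ × (∀ ν → IsEigenvalue A ν → ν ≤ʳ μ)

------------------------------------------------------------------------
-- Simple graphs

record Graph (V : Set) : Set where
  field
    adj       : V → V → Bool
    symmetric : ∀ u v → adj u v ≡ adj v u
    loopless  : ∀ v → adj v v ≡ false

open Graph public

infix 4 _≅_

_≅_ : ∀ {V W} → Graph V → Graph W → Set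
_≅_ {V} {W} G H = Σ[ f ∈ V ↔ W ]
  (∀ u v → adj G u v ≡ adj H (Inverse.to f u) (Inverse.to f v))

K : ∀ s → Graph (Fin s)
K s = record
  { adj       = λ u v → not ⌊ u ≟ᶠ v ⌋
  ; symmetric = λ u v → cong not (≟-sym u v)
  ; loopless  = λ v → cong not (≟-refl v)
  }
  where
  ≟-refl : (v : Fin s) → ⌊ v ≟ᶠ v ⌋ ≡ true
  ≟-refl v with v ≟ᶠ v
  ... | yes _  = refl
  ... | no v≢v = contradiction refl v≢v
  ≟-sym : (u v : Fin s) → ⌊ u ≟ᶠ v ⌋ ≡ ⌊ v ≟ᶠ u ⌋
  ≟-sym u v with u ≟ᶠ v | v ≟ᶠ u
  ... | yes _   | yes _   = refl
  ... | no _    | no _    = refl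
  ... | yes u≡v | no v≢u  = contradiction (sym u≡v) v≢u
  ... | no u≢v  | yes v≡u = contradiction (sym v≡u) u≢v

I : ∀ t → Graph (Fin t)
I t = record
  { adj       = λ _ _ → false
  ; symmetric = λ _ _ → refl
  ; loopless  = λ _ → refl
  }

-- Vertices from different sides are all adjacent (b = true) or all
-- nonadjacent (b = false).
combine : Bool → ∀ {V W} → Graph V → Graph W → Graph (V ⊎ W)
combine b {V} {W} G H = record { adj = a ; symmetric = a-sym ; loopless = a-loopless }
  where
  a : V ⊎ W → V ⊎ W → Bool
  a (inj₁ u) (inj₁ v) = adj G u v
  a (inj₂ u) (inj₂ v) = adj H u v
  a (inj₁ _) (inj₂ _) = b
  a (inj₂ _) (inj₁ _) = b
  a-sym : ∀ u v → a u v ≡ a v u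
  a-sym (inj₁ u) (inj₁ v) = symmetric G u v
  a-sym (inj₂ u) (inj₂ v) = symmetric H u v
  a-sym (inj₁ _) (inj₂ _) = refl
  a-sym (inj₂ _) (inj₁ _) = refl
  a-loopless : ∀ v → a v v ≡ false
  a-loopless (inj₁ v) = loopless G v
  a-loopless (inj₂ v) = loopless H v

infixr 6 _∪_ _∨_

_∪_ _∨_ : ∀ {V W} → Graph V → Graph W → Graph (V ⊎ W)
_∪_ = combine false
_∨_ = combine true

-- For a predicate P with at most one proof at each vertex, the subgraph
-- induced by { v | P v }.
induced : ∀ {V} → Graph V → (P : V → Set) → Graph (Σ V P)
induced G P = record
  { adj       = λ u v → adj G (proj₁ u) (proj₁ v)
  ; symmetric = λ u v → symmetric G (proj₁ u) (proj₁ v)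
  ; loopless  = λ v → loopless G (proj₁ v)
  }

-- A Hamilton cycle lists every vertex exactly once in cyclic order; a
-- cycle has length 3 + m for some m.
Hamiltonian : ∀ {V} → Graph V → Set
Hamiltonian {V} G = ∃[ m ] Σ[ c ∈ Fin (3 ℕ.+ m) ↔ V ]
  (∀ i → adj G (Inverse.to c i) (Inverse.to c (suc (toℕ i) mod (3 ℕ.+ m))) ≡ true)

-- All proofs of v ∉ X are equal, because all proofs of ⊥ are.
_-Hamiltonian_ : ℕ → ∀ {n} → Graph (Fin n) → Set
k -Hamiltonian G = ∀ X → ∣ X ∣ ℕ.≤ k → Hamiltonian (induced G (_∉ X))

neighbours : ∀ {n} → Graph (Fin n) → Fin n → Subset n
neighbours G v = tabulate (adj G v)

degree : ∀ {n} → Graph (Fin n) → Fin n → ℕ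
degree G v = ∣ neighbours G v ∣

-- The default value n exceeds every degree, so it is returned only for
-- the graph without vertices.
minDegree : ∀ {n} → Graph (Fin n) → ℕ
minDegree {n} G = min n (map (degree G) (allFin n))

adjacencyMatrix : ∀ {n} → Graph (Fin n) → Matrix n
adjacencyMatrix G i j = if adj G i j then 1ʳ else 0ʳ

IsSpectralRadius : ∀ {n} → Graph (Fin n) → ℝ → Set
IsSpectralRadius G = IsLargestEigenvalue (adjacencyMatrix G)

------------------------------------------------------------------------
-- The extremal graphs.  The truncated subtractions agree with those of ℤ
-- when k ≤ δ, 2 δ ≤ n + k and δ + 1 ≤ n, and then both graphs have
-- n vertices.

H : ∀ n k δ → Graph (Fin δ ⊎ Fin (n ℕ.+ k ℕ.∸ 2 ℕ.* δ) ⊎ Fin (δ ℕ.∸ k))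
H n k δ = K δ ∨ (K (n ℕ.+ k ℕ.∸ 2 ℕ.* δ) ∪ I (δ ℕ.∸ k))

L : ∀ n k δ → Graph (Fin (k ℕ.+ 1) ⊎ Fin (n ℕ.∸ δ ℕ.∸ 1) ⊎ Fin (δ ℕ.∸ k))
L n k δ = K (k ℕ.+ 1) ∨ (K (n ℕ.∸ δ ℕ.∸ 1) ∪ K (δ ℕ.∸ k))

-- Put t = δ - k and c = n - t - 1.  If some positive vector z satisfies
-- A z < c z entrywise then every eigenvalue is below c, so the spectral
-- hypothesis excludes all such z; suitable z show that G has few vertices of
-- degree below about n/2, and at most t of bounded degree.
--
-- For |X| ≤ k let M be the Bondy–Chvátal closure of G - X.  Its vertices of
-- degree at least |M|/2 form a clique B, and each vertex of the rest S has
-- degree at most |S| ≤ t in M, while the minimum degree gives at least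
-- t + k - |X|.  So either S is empty and M is complete, or |X| = k, |S| = t,
-- every vertex of S has degree t in M, and all of S is joined to the same j
-- vertices of B.  If 1 < j < t then M is Hamiltonian, by Ore's theorem applied
-- to S together with j - 1 of these vertices.  If j = 1 or j = t then G is a
-- spanning subgraph of L or H with all edges at S present, and one more
-- vector z shows that no edge is missing.

module Submission where

open import Defs
open import Data.Fin.Base using (Fin)
open import Data.Integer.Base using (+_; _+_; _-_)
open import Data.Nat.Base using (ℕ; _≤_) renaming (_+_ to _+ℕ_)
open import Data.Product.Base using (∃-syntax)
open import Data.Sum.Base using (_⊎_)

open import Algebra.Bundles using (CommutativeRing)
import Algebra.Properties.Semiring.Sum
open import Data.Bool.Base using (Bool; true; false; if_then_else_; not) renaming (_∨_ to _or_; _∧_ to _and_)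
open import Data.Bool.Properties using (∨-comm) renaming (_≟_ to _≟ᵇ_)
open import Data.Fin.Base using (zero; suc; toℕ)
import Data.Fin.Properties as Fin
open import Data.Fin.Subset using (Subset; ∣_∣; inside; outside) renaming (_∉_ to _∉ˢ_)
import Data.Integer.Base as ℤ
import Data.Integer.Properties as ℤ
open import Data.Integer.Solver using () renaming (module +-*-Solver to ℤ-Solver)
open import Data.List.Base as List using (List; []; _∷_; _++_; length; allFin; filter; lookup; map)
open import Data.List.Extrema.Nat using (min≤xs)
import Data.List.Membership.DecPropositional as DecMembership
open import Data.List.Membership.Propositional using (_∈_; _∉_; find; lose)
open import Data.List.Membership.Propositional.Properties
  using (∈-allFin; ∈-++⁺ˡ; ∈-++⁺ʳ; ∈-++⁻; ∈-filter⁻; ∈-filter⁺; ∈-lookup; ∈-map⁺)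
open import Data.List.Properties using (map-++; length-tabulate; length-++; ++-assoc)
open import Data.List.Relation.Binary.Permutation.Propositional
  using (_↭_; ↭-refl; ↭-sym; ↭-trans; ↭-reflexive; prep; ↭⇒↭ₛ)
import Data.List.Relation.Binary.Permutation.Propositional.Properties as Perm
import Data.List.Relation.Binary.Permutation.Setoid.Properties as PermS
open import Data.List.Relation.Unary.All as All using ([]; _∷_)
open import Data.List.Relation.Unary.AllPairs using ([]; _∷_)
open import Data.List.Relation.Unary.Any as Any using (here; there; any?)
open import Data.List.Relation.Unary.Any.Properties using (lookup-index)
open import Data.List.Relation.Unary.Unique.Propositional using (Unique)
open import Data.List.Relation.Unary.Unique.Propositional.Properties using (allFin⁺)
open import Data.Nat.Base as ℕ using (zero; suc; _*_; _∸_; _<_; z≤n; s≤s)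
open import Data.Nat.DivMod using (_mod_; m<n⇒m%n≡m; n%n≡0)
open import Data.Nat.Induction using (<-wellFounded)
import Data.Nat.ListAction as ListAction
open import Data.Nat.ListAction.Properties using (sum-++; sum-↭)
import Data.Nat.Properties as ℕ
open import Data.Nat.Solver using () renaming (module +-*-Solver to ℕ-Solver)
open import Data.Product.Base using (Σ-syntax; _×_; _,_; proj₁; proj₂)
open import Data.Rational.Base as ℚ using (ℚ; 0ℚ; 1ℚ; ½; nonNegative)
import Data.Rational.Properties as ℚ
open import Data.Rational.Solver using () renaming (module +-*-Solver to ℚ-Solver)
open import Data.Rational.Unnormalised.Base using (mkℚᵘ; *≡*)
import Data.Rational.Unnormalised.Properties as ℚᵘ
open import Data.Sum.Base using (inj₁; inj₂)
import Data.Vec.Base as Vec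
import Data.Vec.Properties as Vec
open import Function.Base using (_∘_; id)
open import Function.Bundles using (_↔_; mk↔ₛ′)
open import Induction.WellFounded using (Acc; acc)
open import Relation.Binary.Definitions using (DecidableEquality)
open import Relation.Binary.PropositionalEquality
  using (_≡_; _≢_; refl; sym; trans; cong; cong₂; subst; subst₂; setoid; module ≡-Reasoning)
open import Relation.Nullary using (¬_; Dec; yes; no; does; contradiction)
open import Relation.Nullary.Decidable using (¬?; _×-dec_; ⌊_⌋; dec-true; dec-false)
open import Relation.Unary using (Decidable)

open Algebra.Properties.Semiring.Sum (CommutativeRing.semiring ℚ.+-*-commutativeRing)
  using (sum; sum-cong-≗; ∑-distrib-+; ∑-comm; *-distribˡ-sum)

-- The complete graph on c + 1 = n - t vertices has spectral radius exactly c, so the hypothesis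
-- asks G to do at least as well as a clique on all but t vertices. Two costs decide the outcome.
-- More than t vertices of small degree carry too little weight, whatever their edges. An edge
-- missing among the other c + 1 vertices costs order 1/c, while boundedly many edges to t vertices
-- of weight order 1/c give back only order 1/c²; hence nothing can be missing once n is large.
-- Membership in S says only that the degree is below about n/2, so |S| is bounded in two rounds: a
-- crude bound 3t makes S small against |M|, closedness then bounds the degrees in S, and only
-- bounded degrees allow weights skewed enough to reach the sharp bound t. Test vectors have natural
-- entries, so the combinatorial part is arithmetic in ℕ. Real numbers enter at one place, where the
-- eigenvalue equation is known only up to an error at each index and that error has to be absorbed.

private variable
  V : Set

-- Sums over lists

∑ˡ : (V → ℕ) → List V → ℕ
∑ˡ f xs = ListAction.sum (map f xs)

ind : Bool → ℕ
ind b = if b then 1 else 0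

count : (V → Bool) → List V → ℕ
count p = ∑ˡ (ind ∘ p)

ind≤1 : ∀ b → ind b ≤ 1
ind≤1 true  = ℕ.≤-refl
ind≤1 false = z≤n

ind-mono : ∀ a b → (a ≡ true → b ≡ true) → ind a ≤ ind b
ind-mono false b     _ = z≤n
ind-mono true  true  _ = ℕ.≤-refl
ind-mono true  false i = contradiction (i refl) (λ ())

∑ˡ-++ : ∀ (f : V → ℕ) xs ys → ∑ˡ f (xs ++ ys) ≡ ∑ˡ f xs +ℕ ∑ˡ f ys
∑ˡ-++ f xs ys = trans (cong ListAction.sum (map-++ f xs ys)) (sum-++ (map f xs) (map f ys))

∑ˡ-↭ : ∀ (f : V → ℕ) {xs ys} → xs ↭ ys → ∑ˡ f xs ≡ ∑ˡ f ys
∑ˡ-↭ f p = sum-↭ (Perm.map⁺ f p)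

∑ˡ-mono : ∀ {f g : V → ℕ} xs → (∀ {x} → x ∈ xs → f x ≤ g x) → ∑ˡ f xs ≤ ∑ˡ g xs
∑ˡ-mono []       f≤g = z≤n
∑ˡ-mono (x ∷ xs) f≤g = ℕ.+-mono-≤ (f≤g (here refl)) (∑ˡ-mono xs (f≤g ∘ there))

∑ˡ-cong : ∀ {f g : V → ℕ} xs → (∀ {x} → x ∈ xs → f x ≡ g x) → ∑ˡ f xs ≡ ∑ˡ g xs
∑ˡ-cong xs f≡g = ℕ.≤-antisym (∑ˡ-mono xs (ℕ.≤-reflexive ∘ f≡g)) (∑ˡ-mono xs (ℕ.≤-reflexive ∘ sym ∘ f≡g))

∑ˡ-const : ∀ c (xs : List V) → ∑ˡ (λ _ → c) xs ≡ length xs * c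
∑ˡ-const c []       = refl
∑ˡ-const c (x ∷ xs) = cong (c +ℕ_) (∑ˡ-const c xs)

∑ˡ-+ : ∀ (f g : V → ℕ) xs → ∑ˡ (λ x → f x +ℕ g x) xs ≡ ∑ˡ f xs +ℕ ∑ˡ g xs
∑ˡ-+ f g []       = refl
∑ˡ-+ f g (x ∷ xs) = trans (cong (f x +ℕ g x +ℕ_) (∑ˡ-+ f g xs))
  (solve 4 (λ a b c d → (a :+ b) :+ (c :+ d) := (a :+ c) :+ (b :+ d)) refl (f x) (g x) (∑ˡ f xs) (∑ˡ g xs))
  where open ℕ-Solver

∑ˡ-* : ∀ c (f : V → ℕ) xs → ∑ˡ (λ x → c * f x) xs ≡ c * ∑ˡ f xs
∑ˡ-* c f []       = sym (ℕ.*-zeroʳ c)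
∑ˡ-* c f (x ∷ xs) = trans (cong (c * f x +ℕ_) (∑ˡ-* c f xs)) (sym (ℕ.*-distribˡ-+ c (f x) (∑ˡ f xs)))

-- The room comes from a single known entry. With e = 1 this gives the strict count comparisons;
-- with `u` the diagonal position, where a loopless graph has no edge, it bounds a weighted row by
-- the total minus the row's own weight.
∑ˡ-slack : ∀ {f g : V → ℕ} {u e} xs → u ∈ xs → (∀ {x} → x ∈ xs → f x ≤ g x) →
  f u +ℕ e ≤ g u → ∑ˡ f xs +ℕ e ≤ ∑ˡ g xs
∑ˡ-slack {f = f} {g} {u} {e} (_ ∷ xs) (here refl) f≤g h = begin
  f u +ℕ ∑ˡ f xs +ℕ e    ≡⟨ solve 3 (λ a b c → a :+ b :+ c := (a :+ c) :+ b) refl (f u) (∑ˡ f xs) e ⟩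
  f u +ℕ e +ℕ ∑ˡ f xs    ≤⟨ ℕ.+-mono-≤ h (∑ˡ-mono xs (f≤g ∘ there)) ⟩
  g u +ℕ ∑ˡ g xs        ∎
  where
  open ℕ.≤-Reasoning
  open ℕ-Solver
∑ˡ-slack {f = f} {g} {u} {e} (x ∷ xs) (there u∈xs) f≤g h = begin
  f x +ℕ ∑ˡ f xs +ℕ e    ≡⟨ ℕ.+-assoc (f x) (∑ˡ f xs) e ⟩
  f x +ℕ (∑ˡ f xs +ℕ e)  ≤⟨ ℕ.+-mono-≤ (f≤g (here refl)) (∑ˡ-slack xs u∈xs (f≤g ∘ there) h) ⟩
  g x +ℕ ∑ˡ g xs        ∎
  where open ℕ.≤-Reasoning

∑ˡ-slack₂ : ∀ {f g : V → ℕ} {u v e e′} xs → u ∈ xs → v ∈ xs → u ≢ v → (∀ {x} → x ∈ xs → f x ≤ g x) →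
  f u +ℕ e ≤ g u → f v +ℕ e′ ≤ g v → ∑ˡ f xs +ℕ e +ℕ e′ ≤ ∑ˡ g xs
∑ˡ-slack₂ (_ ∷ xs) (here refl) (here refl) u≢v _ _ _ = contradiction refl u≢v
∑ˡ-slack₂ {f = f} {g} {u} {v} {e} {e′} (_ ∷ xs) (here refl) (there v∈) _ f≤g hu hv = begin
  f u +ℕ ∑ˡ f xs +ℕ e +ℕ e′
    ≡⟨ solve 4 (λ a b c d → a :+ b :+ c :+ d := (a :+ c) :+ (b :+ d)) refl (f u) (∑ˡ f xs) e e′ ⟩
  f u +ℕ e +ℕ (∑ˡ f xs +ℕ e′)  ≤⟨ ℕ.+-mono-≤ hu (∑ˡ-slack xs v∈ (f≤g ∘ there) hv) ⟩
  g u +ℕ ∑ˡ g xs             ∎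
  where
  open ℕ.≤-Reasoning
  open ℕ-Solver
∑ˡ-slack₂ {f = f} {g} {u} {v} {e} {e′} (_ ∷ xs) (there u∈) (here refl) _ f≤g hu hv = begin
  f v +ℕ ∑ˡ f xs +ℕ e +ℕ e′
    ≡⟨ solve 4 (λ a b c d → a :+ b :+ c :+ d := (a :+ d) :+ (b :+ c)) refl (f v) (∑ˡ f xs) e e′ ⟩
  f v +ℕ e′ +ℕ (∑ˡ f xs +ℕ e)  ≤⟨ ℕ.+-mono-≤ hv (∑ˡ-slack xs u∈ (f≤g ∘ there) hu) ⟩
  g v +ℕ ∑ˡ g xs             ∎
  where
  open ℕ.≤-Reasoning
  open ℕ-Solver
∑ˡ-slack₂ {f = f} {g} {u} {v} {e} {e′} (x ∷ xs) (there u∈) (there v∈) u≢v f≤g hu hv = begin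
  f x +ℕ ∑ˡ f xs +ℕ e +ℕ e′
    ≡⟨ solve 4 (λ a b c d → a :+ b :+ c :+ d := a :+ (b :+ c :+ d)) refl (f x) (∑ˡ f xs) e e′ ⟩
  f x +ℕ (∑ˡ f xs +ℕ e +ℕ e′)  ≤⟨ ℕ.+-mono-≤ (f≤g (here refl)) (∑ˡ-slack₂ xs u∈ v∈ u≢v (f≤g ∘ there) hu hv) ⟩
  g x +ℕ ∑ˡ g xs             ∎
  where
  open ℕ.≤-Reasoning
  open ℕ-Solver

count-++ : ∀ (p : V → Bool) xs ys → count p (xs ++ ys) ≡ count p xs +ℕ count p ys
count-++ p = ∑ˡ-++ (ind ∘ p)

count-↭ : ∀ (p : V → Bool) {xs ys} → xs ↭ ys → count p xs ≡ count p ys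
count-↭ p = ∑ˡ-↭ (ind ∘ p)

∑ˡ-1 : ∀ (xs : List V) → ∑ˡ (λ _ → 1) xs ≡ length xs
∑ˡ-1 xs = trans (∑ˡ-const 1 xs) (ℕ.*-identityʳ _)

count≤length : ∀ (p : V → Bool) xs → count p xs ≤ length xs
count≤length p xs = subst (count p xs ≤_) (∑ˡ-1 xs) (∑ˡ-mono xs λ {x} _ → ind≤1 (p x))

count-all : ∀ (p : V → Bool) xs → (∀ {x} → x ∈ xs → p x ≡ true) → count p xs ≡ length xs
count-all p xs h = trans (∑ˡ-cong xs (λ x∈ → cong ind (h x∈))) (∑ˡ-1 xs)

count-none : ∀ (p : V → Bool) xs → (∀ {x} → x ∈ xs → p x ≡ false) → count p xs ≡ 0
count-none p xs h = trans (∑ˡ-cong xs (λ x∈ → cong ind (h x∈)))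
  (trans (∑ˡ-const 0 xs) (ℕ.*-zeroʳ (length xs)))

count-positive : ∀ (p : V → Bool) {x} xs → x ∈ xs → p x ≡ true → 1 ≤ count p xs
count-positive p (x ∷ xs) (here refl) px rewrite px = s≤s z≤n
count-positive p (x ∷ xs) (there x∈) px = ℕ.≤-trans (count-positive p xs x∈ px) (ℕ.m≤n+m _ (ind (p x)))

count-mono : ∀ {p q : V → Bool} xs → (∀ {x} → x ∈ xs → p x ≡ true → q x ≡ true) → count p xs ≤ count q xs
count-mono {p = p} {q} xs h = ∑ˡ-mono xs λ {x} x∈ → ind-mono (p x) (q x) (h x∈)

count-strict : ∀ {p q : V → Bool} {u} xs → u ∈ xs → (∀ {x} → x ∈ xs → p x ≡ true → q x ≡ true) →
  p u ≡ false → q u ≡ true → count p xs < count q xs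
count-strict {p = p} {q} {u} xs u∈ h pu qu = subst (_≤ count q xs) (ℕ.+-comm (count p xs) 1)
  (∑ˡ-slack xs u∈ (λ {x} x∈ → ind-mono (p x) (q x) (h x∈)) strict)
  where
  strict : ind (p u) +ℕ 1 ≤ ind (q u)
  strict rewrite pu | qu = ℕ.≤-refl

count-miss : ∀ (p : V → Bool) {u} xs → u ∈ xs → p u ≡ false → count p xs < length xs
count-miss p {u} xs u∈ pu = subst (count p xs <_) (count-all (λ _ → true) xs (λ _ → refl))
  (count-strict xs u∈ (λ _ _ → refl) pu refl)

count-miss₂ : ∀ (p : V → Bool) {u v} xs → u ∈ xs → v ∈ xs → u ≢ v → p u ≡ false → p v ≡ false →
  2 +ℕ count p xs ≤ length xs
count-miss₂ p {u} {v} xs u∈ v∈ u≢v pu pv = begin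
  2 +ℕ count p xs    ≡⟨ solve 1 (λ a → con 2 :+ a := a :+ con 1 :+ con 1) refl (count p xs) ⟩
  count p xs +ℕ 1 +ℕ 1  ≤⟨ ∑ˡ-slack₂ xs u∈ v∈ u≢v (λ {x} _ → ind≤1 (p x)) (at pu) (at pv) ⟩
  ∑ˡ (λ _ → 1) xs   ≡⟨ ∑ˡ-1 xs ⟩
  length xs         ∎
  where
  open ℕ.≤-Reasoning
  open ℕ-Solver
  at : ∀ {b} → b ≡ false → ind b +ℕ 1 ≤ 1
  at refl = ℕ.≤-refl

true≢false : ∀ {b} → b ≡ true → b ≢ false
true≢false refl ()

≢false⇒true : ∀ {b} → b ≢ false → b ≡ true
≢false⇒true {true}  _ = refl
≢false⇒true {false} h = contradiction refl h

≢true⇒false : ∀ {b} → b ≢ true → b ≡ false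
≢true⇒false {false} _ = refl
≢true⇒false {true}  h = contradiction refl h

-- Uniqueness keeps `b` from occurring twice, so at most one entry fails `p`. Applied to adjacency
-- in a clique, it says that a vertex misses only itself.
length≤1+count : ∀ (p : V → Bool) {b} xs → Unique xs → b ∈ xs →
  (∀ {x} → x ∈ xs → x ≢ b → p x ≡ true) → length xs ≤ 1 +ℕ count p xs
length≤1+count p (x ∷ xs) (x∉ ∷ u) (here refl) h = s≤s (begin
  length xs               ≡⟨ count-all p xs (λ y∈ → h (there y∈) (All.lookup x∉ y∈ ∘ sym)) ⟨
  count p xs              ≤⟨ ℕ.m≤n+m (count p xs) (ind (p x)) ⟩
  ind (p x) +ℕ count p xs  ∎)
  where open ℕ.≤-Reasoning
length≤1+count p (x ∷ xs) (x∉ ∷ u) (there b∈) h rewrite h (here refl) (All.lookup x∉ b∈) =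
  s≤s (length≤1+count p xs u b∈ (h ∘ there))

filter-split : ∀ {P : V → Set} (P? : Decidable P) xs → xs ↭ filter P? xs ++ filter (¬? ∘ P?) xs
filter-split P? [] = ↭-refl
filter-split P? (x ∷ xs) with P? x
... | yes _ = prep x (filter-split P? xs)
... | no  _ = ↭-trans (prep x (filter-split P? xs)) (↭-sym (Perm.shift x (filter P? xs) (filter (¬? ∘ P?) xs)))

Unique-↭ : ∀ {xs ys : List V} → xs ↭ ys → Unique xs → Unique ys
Unique-↭ p = PermS.Unique-resp-↭ (setoid _) (↭⇒↭ₛ p)

Unique-++⁻ˡ : ∀ (xs : List V) {ys} → Unique (xs ++ ys) → Unique xs
Unique-++⁻ˡ []       _        = []
Unique-++⁻ˡ (x ∷ xs) (x∉ ∷ u) = All.tabulate (λ y∈ → All.lookup x∉ (∈-++⁺ˡ y∈)) ∷ Unique-++⁻ˡ xs u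

Unique-++⁻ʳ : ∀ (xs : List V) {ys} → Unique (xs ++ ys) → Unique ys
Unique-++⁻ʳ []       u       = u
Unique-++⁻ʳ (_ ∷ xs) (_ ∷ u) = Unique-++⁻ʳ xs u

Unique-++-disjoint : ∀ (xs : List V) {ys x y} → Unique (xs ++ ys) → x ∈ xs → y ∈ ys → x ≢ y
Unique-++-disjoint (_ ∷ xs) (x∉ ∷ _) (here refl) y∈ = All.lookup x∉ (∈-++⁺ʳ xs y∈)
Unique-++-disjoint (_ ∷ xs) (_ ∷ u)  (there x∈)  y∈ = Unique-++-disjoint xs u x∈ y∈

-- Paths, Hamilton cycles and the Bondy–Chvátal closure

degIn : Graph V → List V → V → ℕ
degIn G vs v = count (adj G v) vs

-- The list omits the starting vertex.
data Path (G : Graph V) : V → List V → V → Set where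
  stop : ∀ {x} → Path G x [] x
  step : ∀ {x y ys z} → adj G x y ≡ true → Path G y ys z → Path G x (y ∷ ys) z

-- Being a permutation of `vs` encodes that every vertex is visited once. An edge walked forth and
-- back passes as a cycle on two vertices, so the bound 3 ≤ length is carried separately where a
-- genuine cycle matters.
HamCycle : Graph V → List V → Set
HamCycle G vs = ∃[ x ] ∃[ xs ] ∃[ y ] (Path G x xs y × adj G y x ≡ true × x ∷ xs ↭ vs)

adj-sym : ∀ (G : Graph V) {u v} → adj G u v ≡ true → adj G v u ≡ true
adj-sym G {u} {v} = trans (symmetric G v u)

module _ {G : Graph V} where

  join : ∀ {x xs y z zs w} → Path G x xs y → adj G y z ≡ true → Path G z zs w → Path G x (xs ++ z ∷ zs) w
  join stop       e q = step e q
  join (step d p) e q = step d (join p e q)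

  reversePath : ∀ {x xs y} → Path G x xs y → ∃[ ys ] (Path G y ys x × y ∷ ys ↭ x ∷ xs)
  reversePath stop = [] , stop , ↭-refl
  reversePath {x} (step {y = x′} {xs′} {y} e p) with reversePath p
  ... | ys , q , r = ys ++ x ∷ [] , join q (adj-sym G e) stop ,
      ↭-trans (Perm.++-comm (y ∷ ys) (x ∷ [])) (prep x r)

  end∈ : ∀ {x xs y} → Path G x xs y → y ∈ x ∷ xs
  end∈ stop       = here refl
  end∈ (step _ p) = there (end∈ p)

  splitAt : ∀ {x xs y v} → Path G x xs y → v ∈ xs →
    ∃[ l ] ∃[ w ] ∃[ r ] (Path G x l w × adj G w v ≡ true × Path G v r y × xs ≡ l ++ v ∷ r)
  splitAt (step e p) (here refl) = [] , _ , _ , stop , e , p , refl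
  splitAt (step {y = x′} e p) (there v∈) with splitAt p v∈
  ... | l , w , r , p₁ , d , p₂ , refl = x′ ∷ l , w , r , step e p₁ , d , p₂ , refl

  rotate : ∀ {vs v} → HamCycle G vs → v ∈ vs →
    ∃[ xs ] ∃[ y ] (Path G v xs y × adj G y v ≡ true × v ∷ xs ↭ vs)
  rotate (x , xs , y , p , e , r) v∈ with Perm.∈-resp-↭ (↭-sym r) v∈
  ... | here refl = xs , y , p , e , r
  ... | there v∈xs with splitAt p v∈xs
  ... | l , w , m , p₁ , d , p₂ , refl =
      m ++ x ∷ l , w , join p₂ e p₁ , d , ↭-trans (Perm.++-comm (_ ∷ m) (x ∷ l)) r

  Crossing : V → V → V → List V → V → Set
  Crossing u v x xs y = ∃[ l ] ∃[ w ] ∃[ z ] ∃[ r ]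
    (Path G x l w × adj G v w ≡ true × adj G u z ≡ true × Path G z r y × xs ≡ l ++ z ∷ r)

  crossing-step : ∀ {u v x x′ xs y} → adj G x x′ ≡ true → Crossing u v x′ xs y → Crossing u v x (x′ ∷ xs) y
  crossing-step e (l , w , z , r , p , vw , uz , q , refl) = _ ∷ l , w , z , r , step e p , vw , uz , q , refl

  -- Ore's pigeonhole argument, as an induction along the path. A step drops the head of each
  -- counted list: if both heads are hits they form a crossing, otherwise at most one hit is lost
  -- and the inequality survives. The end of the path is no neighbour of `v`, so the search cannot
  -- run out.
  crossing : ∀ {u v x xs y} → Path G x xs y → adj G v y ≡ false →
    length xs < count (adj G u) xs +ℕ count (adj G v) (x ∷ xs) → Crossing u v x xs y
  crossing stop vy h rewrite vy with () ← h
  crossing {u} {v} {x} {x′ ∷ xs} (step e p) vy h with adj G u x′ in ux′ | adj G v x in vx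
  ... | true  | true  = [] , x , x′ , xs , stop , vx , ux′ , p , refl
  ... | true  | false = crossing-step e (crossing p vy (ℕ.≤-pred h))
  ... | false | true  = crossing-step e (crossing p vy
    (ℕ.≤-pred (subst (2 +ℕ length xs ≤_) (ℕ.+-suc (count (adj G u) xs) _) h)))
  ... | false | false = crossing-step e (crossing p vy (ℕ.<⇒≤ h))

  -- With w z consecutive on the path, v adjacent to w and u adjacent to z, reversing the tail turns
  -- u ... w z ... v into the cycle u ... w v ... z u.
  closePath : ∀ {vs u xs v} → Path G u xs v → u ∷ xs ↭ vs →
    length vs ≤ degIn G vs u +ℕ degIn G vs v → HamCycle G vs
  closePath {vs} {u} {xs} {v} p r h with crossing p (loopless G v) lots
    where
    lots : length xs < count (adj G u) xs +ℕ count (adj G v) (u ∷ xs)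
    lots = begin
      length (u ∷ xs)                                     ≡⟨ Perm.↭-length r ⟩
      length vs                                           ≤⟨ h ⟩
      degIn G vs u +ℕ degIn G vs v
        ≡⟨ cong₂ _+ℕ_ (count-↭ (adj G u) r) (count-↭ (adj G v) r) ⟨
      count (adj G u) (u ∷ xs) +ℕ count (adj G v) (u ∷ xs)
        ≡⟨ cong (λ b → ind b +ℕ count (adj G u) xs +ℕ count (adj G v) (u ∷ xs)) (loopless G u) ⟩
      count (adj G u) xs +ℕ count (adj G v) (u ∷ xs)       ∎
      where open ℕ.≤-Reasoning
  ... | l , w , z , m , p₁ , vw , uz , p₂ , refl with reversePath p₂
  ... | m′ , q , s = u , l ++ v ∷ m′ , z , join p₁ (adj-sym G vw) q , adj-sym G uz ,
      ↭-trans (Perm.++⁺ˡ (u ∷ l) s) r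

cliquePath : ∀ (G : Graph V) x xs → Unique (x ∷ xs) →
  (∀ {u v} → u ∈ x ∷ xs → v ∈ x ∷ xs → u ≢ v → adj G u v ≡ true) → ∃[ y ] Path G x xs y
cliquePath G x []       _ _ = x , stop
cliquePath G x (y ∷ xs) ((x≢y ∷ _) ∷ u) h with cliquePath G y xs u (λ a b → h (there a) (there b))
... | z , p = z , step (h (here refl) (there (here refl)) x≢y) p

cliqueCycle : ∀ (G : Graph V) vs → Unique vs → 2 ≤ length vs →
  (∀ {u v} → u ∈ vs → v ∈ vs → u ≢ v → adj G u v ≡ true) → HamCycle G vs
cliqueCycle G (x ∷ y ∷ xs) u@(x∉ ∷ _) _ h with cliquePath G x (y ∷ xs) u h
... | z , step e p = x , y ∷ xs , z , step e p ,
    h (there (end∈ p)) (here refl) (All.lookup x∉ (end∈ p) ∘ sym) , ↭-refl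
cliqueCycle G (x ∷ []) _ (s≤s ()) _

module BondyChvátal {V : Set} (_≟_ : DecidableEquality V) where

  isPair : V → V → V → V → Bool
  isPair u v x y = ⌊ x ≟ u ⌋ and ⌊ y ≟ v ⌋

  isPair-true : ∀ u v {x y} → isPair u v x y ≡ true → x ≡ u × y ≡ v
  isPair-true u v {x} {y} h with x ≟ u | y ≟ v
  ... | yes x≡u | yes y≡v = x≡u , y≡v
  isPair-true u v () | yes _ | no _
  isPair-true u v () | no _  | _

  isPair-refl : ∀ u v → isPair u v u v ≡ true
  isPair-refl u v with u ≟ u | v ≟ v
  ... | yes _ | yes _ = refl
  ... | yes _ | no ¬p = contradiction refl ¬p
  ... | no ¬p | _     = contradiction refl ¬p

  isPair-swap : ∀ u v x y → isPair u v x y ≡ isPair v u y x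
  isPair-swap u v x y with x ≟ u | y ≟ v
  ... | yes _ | yes _ = refl
  ... | yes _ | no _  = refl
  ... | no _  | yes _ = refl
  ... | no _  | no _  = refl

  addEdge : ∀ u v → u ≢ v → Graph V → Graph V
  addEdge u v u≢v G = record
    { adj       = λ x y → adj G x y or (isPair u v x y or isPair v u x y)
    ; symmetric = λ x y → cong₂ _or_ (symmetric G x y)
        (trans (cong₂ _or_ (isPair-swap u v x y) (isPair-swap v u x y)) (∨-comm (isPair v u y x) (isPair u v y x)))
    ; loopless  = λ x → ≢true⇒false λ h → loop x (loopless G x) h
    }
    where
    loop : ∀ x → adj G x x ≡ false → adj G x x or (isPair u v x x or isPair v u x x) ≢ true
    loop x e h rewrite e with isPair u v x x in p
    ... | true  with isPair-true u v p
    ...   | refl , eq = u≢v eq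
    loop x e h | false with isPair-true v u h
    ...   | refl , eq = u≢v (sym eq)

  module _ {u v : V} (u≢v : u ≢ v) (G : Graph V) where

    G⁺ : Graph V
    G⁺ = addEdge u v u≢v G

    addEdge-⊇ : ∀ {x y} → adj G x y ≡ true → adj G⁺ x y ≡ true
    addEdge-⊇ {x} {y} h rewrite h = refl

    addEdge-new : adj G⁺ u v ≡ true
    addEdge-new rewrite isPair-refl u v with adj G u v
    ... | true  = refl
    ... | false = refl

    addEdge-inv : ∀ {x y} → adj G⁺ x y ≡ true → adj G x y ≡ true ⊎ (x ≡ u × y ≡ v) ⊎ (x ≡ v × y ≡ u)
    addEdge-inv {x} {y} h with adj G x y
    ... | true  = inj₁ refl
    ... | false with isPair u v x y in p
    ...   | true  = inj₂ (inj₁ (isPair-true u v p))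
    ...   | false = inj₂ (inj₂ (isPair-true v u h))

    avoids : ∀ {x xs y} → Path G⁺ x xs y → u ∉ x ∷ xs → Path G x xs y
    avoids stop u∉ = stop
    avoids (step e p) u∉ with addEdge-inv e
    ... | inj₁ e′              = step e′ (avoids p (u∉ ∘ there))
    ... | inj₂ (inj₁ (eq , _)) = contradiction (here (sym eq)) u∉
    ... | inj₂ (inj₂ (_ , eq)) = contradiction (there (here (sym eq))) u∉

    -- Rotated to start at `u`, the cycle can use the new edge only as its first or its closing
    -- edge, since the rest of the path avoids `u`. Deleting the new edge leaves a Hamilton path of
    -- G between `u` and `v`, and the degree condition closes it.
    addEdge-HamCycle : ∀ {vs} → Unique vs → u ∈ vs → 3 ≤ length vs →
      length vs ≤ degIn G vs u +ℕ degIn G vs v → HamCycle G⁺ vs → HamCycle G vs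
    addEdge-HamCycle {vs} uniq u∈ 3≤ h c with rotate c u∈
    ... | [] , _ , stop , e , r with s≤s () ← subst (3 ≤_) (sym (Perm.↭-length r)) 3≤
    ... | x ∷ xs , y , step d p , e , r
        with Unique-↭ (↭-sym r) uniq
    ... | u∉ ∷ uniq′ with avoids p (λ u∈′ → All.lookup u∉ u∈′ refl)
    ... | p′ with addEdge-inv d | addEdge-inv e
    ... | inj₁ d′ | inj₁ e′ = u , x ∷ xs , y , step d′ p′ , e′ , r
    ... | inj₁ d′ | inj₂ (inj₂ (refl , _)) = closePath (step d′ p′) r h
    ... | inj₁ d′ | inj₂ (inj₁ (_ , eq)) = contradiction eq u≢v
    ... | inj₂ (inj₂ (eq , _)) | _ = contradiction eq u≢v
    ... | inj₂ (inj₁ (_ , refl)) | inj₁ e′ with reversePath (join p′ e′ stop)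
    ...   | zs , q , s = closePath q (↭-trans s (↭-trans (Perm.++-comm (x ∷ xs) (u ∷ [])) r)) h
    addEdge-HamCycle {vs} uniq u∈ 3≤ h c | x ∷ xs , y , step d p , e , r | u∉ ∷ uniq′ | p′
      | inj₂ (inj₁ (_ , refl)) | inj₂ (inj₁ (_ , eq)) = contradiction eq u≢v
    -- Both edges at `u` are new, so the remaining path runs from `v` to `v`: it is trivial, against
    -- `3≤`, or it repeats `v`.
    addEdge-HamCycle {vs} uniq u∈ 3≤ h c | x ∷ xs , y , step d p , e , r | u∉ ∷ uniq′ | stop
      | inj₂ (inj₁ (_ , refl)) | inj₂ (inj₂ (refl , _)) with s≤s (s≤s ()) ← subst (3 ≤_) (sym (Perm.↭-length r)) 3≤
    addEdge-HamCycle {vs} uniq u∈ 3≤ h c | x ∷ xs , y , step d p , e , r | u∉ ∷ (x∉ ∷ _) | step _ q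
      | inj₂ (inj₁ (_ , refl)) | inj₂ (inj₂ (refl , _)) = contradiction refl (All.lookup x∉ (end∈ q))

  Closed : Graph V → List V → Set
  Closed M vs = ∀ {u v} → u ∈ vs → v ∈ vs → u ≢ v → adj M u v ≡ false → degIn M vs u +ℕ degIn M vs v < length vs

  record Closure (G : Graph V) (vs : List V) : Set where
    field
      graph    : Graph V
      extends  : ∀ {u v} → adj G u v ≡ true → adj graph u v ≡ true
      closed   : Closed graph vs
      reflects : HamCycle graph vs → HamCycle G vs

  Joinable : Graph V → List V → V → V → Set
  Joinable G vs u v = u ≢ v × adj G u v ≡ false × length vs ≤ degIn G vs u +ℕ degIn G vs v

  joinable? : ∀ G vs u v → Dec (Joinable G vs u v)
  joinable? G vs u v = ¬? (u ≟ v) ×-dec ((adj G u v ≟ᵇ false) ×-dec (length vs ℕ.≤? _))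

  nonadjacencies : Graph V → List V → ℕ
  nonadjacencies G vs = ∑ˡ (λ u → count (λ v → not (adj G u v)) vs) vs

  -- Joinable pairs are searched for and joined one at a time. Each new edge lowers the count of
  -- nonadjacent ordered pairs, strictly in the row of `u`, so this stops, and where it stops the
  -- graph is closed.
  closure : ∀ G {vs} → Unique vs → 3 ≤ length vs → Closure G vs
  closure G {vs} uniq 3≤ = go G (<-wellFounded _)
    where
    anti : ∀ {a b} → (a ≡ true → b ≡ true) → not b ≡ true → not a ≡ true
    anti {false} i _ = refl
    anti {true}  i h rewrite i refl = h
    go : ∀ G → Acc _<_ (nonadjacencies G vs) → Closure G vs
    go G (acc rec) with any? (λ u → any? (joinable? G vs u) vs) vs
    ... | no ¬j = record
        { graph = G ; extends = id ; reflects = id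
        ; closed = λ u∈ v∈ u≢v e → ℕ.≰⇒> λ h → ¬j (lose u∈ (lose v∈ (u≢v , e , h))) }
    ... | yes j with find j
    ...   | u , u∈ , j′ with find j′
    ...     | v , v∈ , u≢v , e , h = record
        { graph = graph ; extends = extends ∘ addEdge-⊇ u≢v G ; closed = closed
        ; reflects = addEdge-HamCycle u≢v G uniq u∈ 3≤ h ∘ reflects }
      where
      fewer : nonadjacencies (addEdge u v u≢v G) vs < nonadjacencies G vs
      fewer = subst (_≤ nonadjacencies G vs) (ℕ.+-comm _ 1) (∑ˡ-slack vs u∈
        (λ {x} _ → count-mono vs λ {y} _ → anti (addEdge-⊇ u≢v G))
        (subst (_≤ count (λ y → not (adj G u y)) vs) (ℕ.+-comm 1 _)
        (count-strict vs v∈ (λ {y} _ → anti (addEdge-⊇ u≢v G))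
          (cong not (addEdge-new u≢v G)) (cong not e))))
      open Closure (go (addEdge u v u≢v G) (rec fewer))

-- Spectral bounds from positive test vectors

ι : ℕ → ℚ
ι m = + m ℚ./ 1

ι-+ : ∀ m n → ι (m ℕ.+ n) ≡ ι m ℚ.+ ι n
ι-+ m n = ℚ.toℚᵘ-injective (ℚᵘ.≃-trans (ℚ.toℚᵘ-fromℚᵘ (mkℚᵘ (+ (m ℕ.+ n)) 0)) (ℚᵘ.≃-sym
  (ℚᵘ.≃-trans (ℚ.toℚᵘ-homo-+ (ι m) (ι n))
  (ℚᵘ.≃-trans (ℚᵘ.+-cong (ℚ.toℚᵘ-fromℚᵘ (mkℚᵘ (+ m) 0)) (ℚ.toℚᵘ-fromℚᵘ (mkℚᵘ (+ n) 0)))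
  (*≡* (cong (ℤ._* + 1) (cong₂ ℤ._+_ (ℤ.*-identityʳ (+ m)) (ℤ.*-identityʳ (+ n)))))))))

ι-* : ∀ m n → ι (m ℕ.* n) ≡ ι m ℚ.* ι n
ι-* zero    n = sym (ℚ.*-zeroˡ (ι n))
ι-* (suc m) n = begin
  ι (n ℕ.+ m ℕ.* n)          ≡⟨ ι-+ n (m ℕ.* n) ⟩
  ι n ℚ.+ ι (m ℕ.* n)        ≡⟨ cong (ι n ℚ.+_) (ι-* m n) ⟩
  ι n ℚ.+ ι m ℚ.* ι n        ≡⟨ cong (ℚ._+ ι m ℚ.* ι n) (ℚ.*-identityˡ (ι n)) ⟨
  1ℚ ℚ.* ι n ℚ.+ ι m ℚ.* ι n ≡⟨ ℚ.*-distribʳ-+ (ι n) 1ℚ (ι m) ⟨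
  (1ℚ ℚ.+ ι m) ℚ.* ι n       ≡⟨ cong (ℚ._* ι n) (ι-+ 1 m) ⟨
  ι (suc m) ℚ.* ι n          ∎
  where open ≡-Reasoning

0≤ι : ∀ m → 0ℚ ℚ.≤ ι m
0≤ι m = ℚ.nonNegative⁻¹ (ι m) {{ℚ.normalize-nonNeg m 1}}

ι-mono : ∀ {m n} → m ℕ.≤ n → ι m ℚ.≤ ι n
ι-mono {m} {n} m≤n = begin
  ι m                   ≡⟨ ℚ.+-identityʳ (ι m) ⟨
  ι m ℚ.+ 0ℚ            ≤⟨ ℚ.+-monoʳ-≤ (ι m) (0≤ι (n ℕ.∸ m)) ⟩
  ι m ℚ.+ ι (n ℕ.∸ m)   ≡⟨ ι-+ m (n ℕ.∸ m) ⟨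
  ι (m ℕ.+ (n ℕ.∸ m))   ≡⟨ cong ι (ℕ.m+[n∸m]≡n m≤n) ⟩
  ι n                   ∎
  where open ℚ.≤-Reasoning

*-nonNeg : ∀ {p q} → 0ℚ ℚ.≤ p → 0ℚ ℚ.≤ q → 0ℚ ℚ.≤ p ℚ.* q
*-nonNeg {p} {q} 0≤p 0≤q = subst (ℚ._≤ p ℚ.* q) (ℚ.*-zeroʳ p)
  (ℚ.*-monoˡ-≤-nonNeg p {{nonNegative 0≤p}} 0≤q)

sum-mono : ∀ {n} {f g : Fin n → ℚ} → (∀ i → f i ℚ.≤ g i) → sum f ℚ.≤ sum g
sum-mono {zero}  h = ℚ.≤-refl
sum-mono {suc n} h = ℚ.+-mono-≤ (h zero) (sum-mono (h ∘ suc))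

sum-nonNeg : ∀ {n} {f : Fin n → ℚ} → (∀ i → 0ℚ ℚ.≤ f i) → 0ℚ ℚ.≤ sum f
sum-nonNeg {zero}  h = ℚ.≤-refl
sum-nonNeg {suc n} h = ℚ.+-mono-≤ (h zero) (sum-nonNeg (h ∘ suc))

term≤sum : ∀ {n} {f : Fin n → ℚ} → (∀ i → 0ℚ ℚ.≤ f i) → ∀ i → f i ℚ.≤ sum f
term≤sum {suc n} {f} h zero    = subst (ℚ._≤ sum f) (ℚ.+-identityʳ (f zero))
  (ℚ.+-monoʳ-≤ (f zero) (sum-nonNeg (h ∘ suc)))
term≤sum {suc n} {f} h (suc i) = subst (ℚ._≤ sum f) (ℚ.+-identityˡ (f (suc i)))
  (ℚ.+-mono-≤ (h zero) (term≤sum (h ∘ suc) i))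

∣sum∣≤sum∣∣ : ∀ {n} (f : Fin n → ℚ) → ℚ.∣ sum f ∣ ℚ.≤ sum (λ i → ℚ.∣ f i ∣)
∣sum∣≤sum∣∣ {zero}  f = ℚ.≤-refl
∣sum∣≤sum∣∣ {suc n} f = ℚ.≤-trans (ℚ.∣p+q∣≤∣p∣+∣q∣ (f zero) (sum (f ∘ suc)))
  (ℚ.+-monoʳ-≤ ℚ.∣ f zero ∣ (∣sum∣≤sum∣∣ (f ∘ suc)))

sum-ι : ∀ {n} {A : Set} (f : A → ℕ) (g : Fin n → A) → sum (λ i → ι (f (g i))) ≡ ι (∑ˡ f (List.tabulate g))
sum-ι {zero}  f g = refl
sum-ι {suc n} f g = trans (cong (ι (f (g zero)) ℚ.+_) (sum-ι f (g ∘ suc))) (sym (ι-+ (f (g zero)) _))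

seq-∑ : ∀ {n} (f : Fin n → ℝ) m → seq (∑ f) m ≡ sum (λ i → seq (f i) m)
seq-∑ {zero}  f m = refl
seq-∑ {suc n} f m = cong (seq (f zero) m ℚ.+_) (seq-∑ (f ∘ suc) m)

+-cancelˡ-≤ : ∀ r {p q} → r ℚ.+ p ℚ.≤ r ℚ.+ q → p ℚ.≤ q
+-cancelˡ-≤ r {p} {q} h = begin
  p                         ≡⟨ solve 2 (λ r p → p := (:- r) :+ (r :+ p)) refl r p ⟩
  (ℚ.- r) ℚ.+ (r ℚ.+ p)     ≤⟨ ℚ.+-monoʳ-≤ (ℚ.- r) h ⟩
  (ℚ.- r) ℚ.+ (r ℚ.+ q)     ≡⟨ solve 2 (λ r p → (:- r) :+ (r :+ p) := p) refl r q ⟩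
  q                         ∎
  where
  open ℚ.≤-Reasoning
  open ℚ-Solver

eventually-all : ∀ {k} {P : Fin k → ℕ → Set} → (∀ i → ∃[ N ] ∀ m → N ℕ.≤ m → P i m) →
  ∃[ N ] ∀ m → N ℕ.≤ m → ∀ i → P i m
eventually-all {zero}  h = 0 , λ _ _ ()
eventually-all {suc k} h with h zero | eventually-all (h ∘ suc)
... | M , p | N , q = M ℕ.⊔ N , λ where
  m le zero    → p m (ℕ.m⊔n≤o⇒m≤o M N le)
  m le (suc i) → q m (ℕ.m⊔n≤o⇒n≤o M N le) i

module _ where
  open ℚ.≤-Reasoning
  open ℚ-Solver

  0<1⊓p : ∀ {ε} → 0ℚ ℚ.< ε → 0ℚ ℚ.< 1ℚ ℚ.⊓ ε
  0<1⊓p {ε} 0<ε with ℚ.⊓-sel 1ℚ ε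
  ... | inj₁ eq = subst (0ℚ ℚ.<_) (sym eq) (ℚ.positive⁻¹ 1ℚ)
  ... | inj₂ eq = subst (0ℚ ℚ.<_) (sym eq) 0<ε

  p½<p : ∀ {η} → 0ℚ ℚ.< η → η ℚ.* ½ ℚ.< η
  p½<p {η} 0<η = begin-strict
    η ℚ.* ½                 ≡⟨ ℚ.+-identityˡ _ ⟨
    0ℚ ℚ.+ η ℚ.* ½          <⟨ ℚ.+-monoˡ-< (η ℚ.* ½) (halve η 0<η) ⟩
    η ℚ.* ½ ℚ.+ η ℚ.* ½     ≡⟨ half+half η ⟩
    η                       ∎

  ∣p∣≤1+p : ∀ {Z} → 0ℚ ℚ.≤ Z → ℚ.∣ Z ∣ ℚ.≤ 1ℚ ℚ.+ Z
  ∣p∣≤1+p {Z} 0≤Z = begin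
    ℚ.∣ Z ∣      ≡⟨ ℚ.0≤p⇒∣p∣≡p 0≤Z ⟩
    Z            ≡⟨ ℚ.+-identityˡ Z ⟨
    0ℚ ℚ.+ Z     ≤⟨ ℚ.+-monoˡ-≤ Z (ℚ.<⇒≤ (ℚ.positive⁻¹ 1ℚ)) ⟩
    1ℚ ℚ.+ Z     ∎

  commuted-< : ∀ Z θ ε → 0ℚ ℚ.≤ Z → 0ℚ ℚ.≤ θ → ℚ.∣ Z ℚ.* θ ∣ ℚ.< ε → θ ℚ.* Z ℚ.< ε
  commuted-< Z θ ε 0≤Z 0≤θ h = subst (ℚ._< ε) (trans (ℚ.0≤p⇒∣p∣≡p (*-nonNeg 0≤Z 0≤θ)) (ℚ.*-comm Z θ)) h

  -- As 2e < 1, doubling the hypothesis gives 2T ≤ 2e + T, hence T ≤ 2e < ε.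
  contraction⇒small : ∀ T e ε q → 0ℚ ℚ.≤ T → T ℚ.≤ e ℚ.+ e ℚ.* T → e ℚ.< (1ℚ ℚ.⊓ ε) ℚ.* ½ → ℚ.∣ q ∣ ℚ.≤ T →
    ℚ.∣ q ℚ.- 0ℚ ∣ ℚ.< ε
  contraction⇒small T e ε q 0≤T h e< q≤T = begin-strict
    ℚ.∣ q ℚ.- 0ℚ ∣      ≡⟨ cong ℚ.∣_∣ (ℚ.+-identityʳ q) ⟩
    ℚ.∣ q ∣             ≤⟨ q≤T ⟩
    T                   ≤⟨ +-cancelˡ-≤ T twice ⟩
    e ℚ.+ e             <⟨ 2e<μ ⟩
    1ℚ ℚ.⊓ ε            ≤⟨ ℚ.p⊓q≤q 1ℚ ε ⟩
    ε                   ∎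
    where
    2e<μ : e ℚ.+ e ℚ.< 1ℚ ℚ.⊓ ε
    2e<μ = subst (e ℚ.+ e ℚ.<_) (half+half (1ℚ ℚ.⊓ ε)) (ℚ.+-mono-< e< e<)
    twice : T ℚ.+ T ℚ.≤ T ℚ.+ (e ℚ.+ e)
    twice = begin
      T ℚ.+ T                              ≤⟨ ℚ.+-mono-≤ h h ⟩
      (e ℚ.+ e ℚ.* T) ℚ.+ (e ℚ.+ e ℚ.* T)
        ≡⟨ solve 2 (λ e t → (e :+ e :* t) :+ (e :+ e :* t) := (e :+ e) :* t :+ (e :+ e)) refl e T ⟩
      (e ℚ.+ e) ℚ.* T ℚ.+ (e ℚ.+ e)        ≤⟨ ℚ.+-monoˡ-≤ (e ℚ.+ e) (ℚ.*-monoʳ-≤-nonNeg T {{nonNegative 0≤T}}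
                                                (ℚ.≤-trans (ℚ.<⇒≤ 2e<μ) (ℚ.p⊓q≤p 1ℚ ε))) ⟩
      1ℚ ℚ.* T ℚ.+ (e ℚ.+ e)               ≡⟨ cong (ℚ._+ (e ℚ.+ e)) (ℚ.*-identityˡ T) ⟩
      T ℚ.+ (e ℚ.+ e)                      ∎

module _ where
  open ℚ.≤-Reasoning
  open ℚ-Solver

  p≤∣p∣ : ∀ p → p ℚ.≤ ℚ.∣ p ∣
  p≤∣p∣ p with ℚ.≤-total 0ℚ p
  ... | inj₁ 0≤p = ℚ.≤-reflexive (sym (ℚ.0≤p⇒∣p∣≡p 0≤p))
  ... | inj₂ p≤0 = ℚ.≤-trans p≤0 (ℚ.0≤∣p∣ p)

  -- One row of A |x| ≥ c |x| at a finite index, where `r` approximates the eigenvalue and `s` the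
  -- entry of A x. The errors in c ≤ ρ and in the eigenvalue equation are at most θ each and collect
  -- in θ (1 + |x|).
  eigenrow-≤ : ∀ c r x s t θ → c ℚ.< r ℚ.+ θ → ℚ.∣ s ∣ ℚ.≤ t → ℚ.∣ s ℚ.- r ℚ.* x ∣ ℚ.< θ →
    c ℚ.* ℚ.∣ x ∣ ℚ.≤ t ℚ.+ θ ℚ.* (1ℚ ℚ.+ ℚ.∣ x ∣)
  eigenrow-≤ c r x s t θ big s≤t close = begin
    c ℚ.* ℚ.∣ x ∣
      ≤⟨ ℚ.*-monoʳ-≤-nonNeg ℚ.∣ x ∣ {{nonNegative (ℚ.0≤∣p∣ x)}} (ℚ.<⇒≤ big) ⟩
    (r ℚ.+ θ) ℚ.* ℚ.∣ x ∣
      ≡⟨ ℚ.*-distribʳ-+ ℚ.∣ x ∣ r θ ⟩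
    r ℚ.* ℚ.∣ x ∣ ℚ.+ θ ℚ.* ℚ.∣ x ∣
      ≤⟨ ℚ.+-monoˡ-≤ (θ ℚ.* ℚ.∣ x ∣) rX ⟩
    (t ℚ.+ θ) ℚ.+ θ ℚ.* ℚ.∣ x ∣
      ≡⟨ solve 3 (λ s θ x → (s :+ θ) :+ θ :* x := s :+ θ :* (con 1ℚ :+ x)) refl t θ ℚ.∣ x ∣ ⟩
    t ℚ.+ θ ℚ.* (1ℚ ℚ.+ ℚ.∣ x ∣) ∎
    where
    rX : r ℚ.* ℚ.∣ x ∣ ℚ.≤ t ℚ.+ θ
    rX = begin
      r ℚ.* ℚ.∣ x ∣        ≤⟨ ℚ.*-monoʳ-≤-nonNeg ℚ.∣ x ∣ {{nonNegative (ℚ.0≤∣p∣ x)}} (p≤∣p∣ r) ⟩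
      ℚ.∣ r ∣ ℚ.* ℚ.∣ x ∣  ≡⟨ ℚ.∣p*q∣≡∣p∣*∣q∣ r x ⟨
      ℚ.∣ r ℚ.* x ∣        ≡⟨ cong ℚ.∣_∣ (solve 2 (λ p s → p := s :- (s :- p)) refl (r ℚ.* x) s) ⟩
      ℚ.∣ s ℚ.- (s ℚ.- r ℚ.* x) ∣     ≤⟨ ℚ.∣p-q∣≤∣p∣+∣q∣ s _ ⟩
      ℚ.∣ s ∣ ℚ.+ ℚ.∣ s ℚ.- r ℚ.* x ∣ ≤⟨ ℚ.+-mono-≤ s≤t (ℚ.<⇒≤ close) ⟩
      t ℚ.+ θ ∎

-- `scale` needs a positive bound, and Z may be 0, so it is called with 1 + Z; its answer is halved
-- because it accepts only arguments strictly below η.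
tolerance : ∀ Z ε → 0ℚ ℚ.≤ Z → 0ℚ ℚ.< ε → ∃[ θ ] (0ℚ ℚ.< θ × θ ℚ.* Z ℚ.< (1ℚ ℚ.⊓ ε) ℚ.* ½)
tolerance Z ε 0≤Z 0<ε = halved (scale (1ℚ ℚ.+ Z) μ (ℚ.+-mono-<-≤ (ℚ.positive⁻¹ 1ℚ) 0≤Z) (halve (1ℚ ℚ.⊓ ε) (0<1⊓p 0<ε)))
  where
  μ : ℚ
  μ = (1ℚ ℚ.⊓ ε) ℚ.* ½
  halved : ∃[ η ] (0ℚ ℚ.< η × ∀ a b → ℚ.∣ a ∣ ℚ.≤ 1ℚ ℚ.+ Z → ℚ.∣ b ∣ ℚ.< η → ℚ.∣ a ℚ.* b ∣ ℚ.< μ) →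
    ∃[ θ ] (0ℚ ℚ.< θ × θ ℚ.* Z ℚ.< μ)
  halved (η , 0<η , small) = η ℚ.* ½ , 0<θ , commuted-< Z (η ℚ.* ½) μ 0≤Z (ℚ.<⇒≤ 0<θ)
    (small Z (η ℚ.* ½) (∣p∣≤1+p 0≤Z) (subst (ℚ._< η) (sym (ℚ.0≤p⇒∣p∣≡p (ℚ.<⇒≤ 0<θ))) (p½<p 0<η)))
    where
    0<θ : 0ℚ ℚ.< η ℚ.* ½
    0<θ = halve η 0<η

module _ {n : ℕ} (G : Graph (Fin n)) where

  weightedDegree : (Fin n → ℕ) → Fin n → ℕ
  weightedDegree z i = ∑ˡ (λ j → if adj G i j then z j else 0) (allFin n)

  -- Between natural numbers the strict inequality is a gap of at least 1, uniform over the rows,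
  -- and it forces every entry of `z` to be positive.
  TestVector : ℕ → (Fin n → ℕ) → Set
  TestVector c z = ∀ i → weightedDegree z i ℕ.< c ℕ.* z i

  aℚ : Fin n → Fin n → ℚ
  aℚ i j = if adj G i j then 1ℚ else 0ℚ

  module _ {c : ℕ} {z : Fin n → ℕ} (sub : TestVector c z)
           (X : Fin n → ℚ) (0≤X : ∀ i → 0ℚ ℚ.≤ X i) (η : ℚ) (0≤η : 0ℚ ℚ.≤ η)
           (super : ∀ i → ι c ℚ.* X i ℚ.≤ sum (λ j → aℚ i j ℚ.* X j) ℚ.+ η ℚ.* (1ℚ ℚ.+ X i)) where

    private
      ẑ : Fin n → ℚ
      ẑ i = ι (z i)
      Z : ℚ
      Z = sum ẑ
      w : Fin n → ℚ
      w i = ι (weightedDegree z i)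

      w-sum : ∀ j → sum (λ i → aℚ i j ℚ.* ẑ i) ≡ w j
      w-sum j = trans (sum-cong-≗ (λ i → term (symmetric G i j))) (sum-ι (λ i → if adj G j i then z i else 0) id)
        where
        term : ∀ {i} → adj G i j ≡ adj G j i → aℚ i j ℚ.* ẑ i ≡ ι (if adj G j i then z i else 0)
        term {i} eq rewrite eq with adj G j i
        ... | true  = ℚ.*-identityˡ (ẑ i)
        ... | false = ℚ.*-zeroˡ (ẑ i)

      exchange : sum (λ i → ẑ i ℚ.* sum (λ j → aℚ i j ℚ.* X j)) ≡ sum (λ j → X j ℚ.* w j)
      exchange = begin
        sum (λ i → ẑ i ℚ.* sum (λ j → aℚ i j ℚ.* X j))
          ≡⟨ sum-cong-≗ (λ i → *-distribˡ-sum (ẑ i) (λ j → aℚ i j ℚ.* X j)) ⟩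
        sum (λ i → sum (λ j → ẑ i ℚ.* (aℚ i j ℚ.* X j)))
          ≡⟨ ∑-comm (λ i j → ẑ i ℚ.* (aℚ i j ℚ.* X j)) ⟩
        sum (λ j → sum (λ i → ẑ i ℚ.* (aℚ i j ℚ.* X j)))
          ≡⟨ sum-cong-≗ (λ j → sum-cong-≗ (λ i → solve 3 (λ z a x → z :* (a :* x) := x :* (a :* z)) refl (ẑ i) (aℚ i j) (X j))) ⟩
        sum (λ j → sum (λ i → X j ℚ.* (aℚ i j ℚ.* ẑ i)))
          ≡⟨ sum-cong-≗ (λ j → *-distribˡ-sum (X j) (λ i → aℚ i j ℚ.* ẑ i)) ⟨
        sum (λ j → X j ℚ.* sum (λ i → aℚ i j ℚ.* ẑ i))
          ≡⟨ sum-cong-≗ (λ j → cong (X j ℚ.*_) (w-sum j)) ⟩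
        sum (λ j → X j ℚ.* w j) ∎
        where
        open ≡-Reasoning
        open ℚ-Solver

      P : ℚ
      P = sum (λ j → X j ℚ.* w j)

    -- Pair the inequality for X with z. By symmetry of A the pairings ⟨z, A X⟩ and ⟨X, A z⟩ are the
    -- same number P, and the gap of 1 in the test vector leaves a whole ∑ X on the left after P
    -- cancels. The error term uses z i ≤ Z.
    sum-bound : sum X ℚ.≤ η ℚ.* Z ℚ.+ (η ℚ.* Z) ℚ.* sum X
    sum-bound = +-cancelˡ-≤ P (begin
      P ℚ.+ sum X
        ≡⟨ ∑-distrib-+ (λ j → X j ℚ.* w j) X ⟨
      sum (λ j → X j ℚ.* w j ℚ.+ X j)
        ≤⟨ sum-mono lower ⟩
      sum (λ i → ẑ i ℚ.* (ι c ℚ.* X i))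
        ≤⟨ sum-mono (λ i → ℚ.*-monoˡ-≤-nonNeg (ẑ i) {{nonNegative (0≤ι (z i))}} (super i)) ⟩
      sum (λ i → ẑ i ℚ.* (sum (λ j → aℚ i j ℚ.* X j) ℚ.+ η ℚ.* (1ℚ ℚ.+ X i)))
        ≤⟨ sum-mono (λ i → upper i (sum (λ j → aℚ i j ℚ.* X j))) ⟩
      sum (λ i → ẑ i ℚ.* sum (λ j → aℚ i j ℚ.* X j) ℚ.+ (η ℚ.* ẑ i ℚ.+ (η ℚ.* Z) ℚ.* X i))
        ≡⟨ ∑-distrib-+ (λ i → ẑ i ℚ.* sum (λ j → aℚ i j ℚ.* X j)) _ ⟩
      sum (λ i → ẑ i ℚ.* sum (λ j → aℚ i j ℚ.* X j)) ℚ.+ sum (λ i → η ℚ.* ẑ i ℚ.+ (η ℚ.* Z) ℚ.* X i)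
        ≡⟨ cong₂ ℚ._+_ exchange (∑-distrib-+ (λ i → η ℚ.* ẑ i) (λ i → (η ℚ.* Z) ℚ.* X i)) ⟩
      P ℚ.+ (sum (λ i → η ℚ.* ẑ i) ℚ.+ sum (λ i → (η ℚ.* Z) ℚ.* X i))
        ≡⟨ cong (P ℚ.+_) (cong₂ ℚ._+_ (*-distribˡ-sum η ẑ) (*-distribˡ-sum (η ℚ.* Z) X)) ⟨
      P ℚ.+ (η ℚ.* Z ℚ.+ (η ℚ.* Z) ℚ.* sum X) ∎)
      where
      open ℚ.≤-Reasoning
      open ℚ-Solver
      lower : ∀ j → X j ℚ.* w j ℚ.+ X j ℚ.≤ ẑ j ℚ.* (ι c ℚ.* X j)
      lower j = begin
        X j ℚ.* w j ℚ.+ X j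
          ≡⟨ solve 2 (λ x w → x :* w :+ x := x :* (con 1ℚ :+ w)) refl (X j) (w j) ⟩
        X j ℚ.* (1ℚ ℚ.+ w j)             ≡⟨ cong (X j ℚ.*_) (ι-+ 1 (weightedDegree z j)) ⟨
        X j ℚ.* ι (suc (weightedDegree z j))
          ≤⟨ ℚ.*-monoˡ-≤-nonNeg (X j) {{nonNegative (0≤X j)}} (ι-mono (sub j)) ⟩
        X j ℚ.* ι (c ℕ.* z j)            ≡⟨ cong (X j ℚ.*_) (ι-* c (z j)) ⟩
        X j ℚ.* (ι c ℚ.* ẑ j)
          ≡⟨ solve 3 (λ x c z → x :* (c :* z) := z :* (c :* x)) refl (X j) (ι c) (ẑ j) ⟩
        ẑ j ℚ.* (ι c ℚ.* X j)            ∎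
      upper : ∀ i s → ẑ i ℚ.* (s ℚ.+ η ℚ.* (1ℚ ℚ.+ X i)) ℚ.≤ ẑ i ℚ.* s ℚ.+ (η ℚ.* ẑ i ℚ.+ (η ℚ.* Z) ℚ.* X i)
      upper i s = begin
        ẑ i ℚ.* (s ℚ.+ η ℚ.* (1ℚ ℚ.+ X i))
          ≡⟨ solve 4 (λ z s η x → z :* (s :+ η :* (con 1ℚ :+ x)) := z :* s :+ (η :* z :+ (η :* x) :* z)) refl (ẑ i) s η (X i) ⟩
        ẑ i ℚ.* s ℚ.+ (η ℚ.* ẑ i ℚ.+ (η ℚ.* X i) ℚ.* ẑ i)
          ≤⟨ ℚ.+-monoʳ-≤ (ẑ i ℚ.* s) (ℚ.+-monoʳ-≤ (η ℚ.* ẑ i)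
               (ℚ.*-monoˡ-≤-nonNeg (η ℚ.* X i) {{nonNegative (*-nonNeg 0≤η (0≤X i))}} (term≤sum (0≤ι ∘ z) i))) ⟩
        ẑ i ℚ.* s ℚ.+ (η ℚ.* ẑ i ℚ.+ (η ℚ.* X i) ℚ.* Z)
          ≡⟨ cong (λ e → ẑ i ℚ.* s ℚ.+ (η ℚ.* ẑ i ℚ.+ e))
               (solve 3 (λ η x z → (η :* x) :* z := (η :* z) :* x) refl η (X i) Z) ⟩
        ẑ i ℚ.* s ℚ.+ (η ℚ.* ẑ i ℚ.+ (η ℚ.* Z) ℚ.* X i) ∎

  super : ∀ {ρ c x} m θ →
    (∀ i → ℚ.∣ seq ((adjacencyMatrix G · x) i) m ℚ.- seq ρ m ℚ.* seq (x i) m ∣ ℚ.< θ) →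
    ι c ℚ.< seq ρ m ℚ.+ θ → ∀ i →
    ι c ℚ.* ℚ.∣ seq (x i) m ∣ ℚ.≤ sum (λ j → aℚ i j ℚ.* ℚ.∣ seq (x j) m ∣) ℚ.+ θ ℚ.* (1ℚ ℚ.+ ℚ.∣ seq (x i) m ∣)
  super {ρ} {c} {x} m θ close big i = eigenrow-≤ (ι c) (seq ρ m) (seq (x i) m) _ _ θ big ∣S∣≤ (close i)
    where
    open ℚ.≤-Reasoning
    entry : ∀ b (y : ℝ) → ℚ.∣ seq ((if b then 1ʳ else 0ʳ) *ʳ y) m ∣ ≡ (if b then 1ℚ else 0ℚ) ℚ.* ℚ.∣ seq y m ∣
    entry true  y = trans (cong ℚ.∣_∣ (ℚ.*-identityˡ (seq y m))) (sym (ℚ.*-identityˡ ℚ.∣ seq y m ∣))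
    entry false y = trans (cong ℚ.∣_∣ (ℚ.*-zeroˡ (seq y m))) (sym (ℚ.*-zeroˡ ℚ.∣ seq y m ∣))
    ∣S∣≤ : ℚ.∣ seq ((adjacencyMatrix G · x) i) m ∣ ℚ.≤ sum (λ j → aℚ i j ℚ.* ℚ.∣ seq (x j) m ∣)
    ∣S∣≤ = begin
      ℚ.∣ seq ((adjacencyMatrix G · x) i) m ∣
        ≡⟨ cong ℚ.∣_∣ (seq-∑ (λ j → adjacencyMatrix G i j *ʳ x j) m) ⟩
      ℚ.∣ sum (λ j → seq (adjacencyMatrix G i j *ʳ x j) m) ∣
        ≤⟨ ∣sum∣≤sum∣∣ (λ j → seq (adjacencyMatrix G i j *ʳ x j) m) ⟩
      sum (λ j → ℚ.∣ seq (adjacencyMatrix G i j *ʳ x j) m ∣)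
        ≡⟨ sum-cong-≗ (λ j → entry (adj G i j) (x j)) ⟩
      sum (λ j → aℚ i j ℚ.* ℚ.∣ seq (x j) m ∣) ∎

  -- Collatz–Wielandt: A z < c z forces every x with A x = ρ x, ρ ≥ c, to
  -- vanish, as A |x| ≥ c |x| and A is symmetric.
  noTestVector : ∀ {ρ c} → IsEigenvalue (adjacencyMatrix G) ρ → fromℤ (+ c) ≤ʳ ρ → ∀ z → ¬ TestVector c z
  noTestVector {ρ} {c} (x , x≉0 , eigen) c≤ρ z sub = x≉0 λ i ε 0<ε →
    vanish i ε (tolerance (sum (λ i → ι (z i))) ε (sum-nonNeg (0≤ι ∘ z)) 0<ε)
    where
    vanish : ∀ i ε → ∃[ θ ] (0ℚ ℚ.< θ × θ ℚ.* sum (λ i → ι (z i)) ℚ.< (1ℚ ℚ.⊓ ε) ℚ.* ½) →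
      ∃[ N ] ∀ m → N ℕ.≤ m → ℚ.∣ seq (x i) m ℚ.- 0ℚ ∣ ℚ.< ε
    vanish i ε (θ , 0<θ , θZ<) = combine-bounds (eventually-all (λ i → eigen i θ 0<θ)) (c≤ρ θ 0<θ)
      where
      combine-bounds :
        (∃[ N ] ∀ m → N ℕ.≤ m → ∀ i → ℚ.∣ seq ((adjacencyMatrix G · x) i) m ℚ.- seq ρ m ℚ.* seq (x i) m ∣ ℚ.< θ) →
        (∃[ N ] ∀ m → N ℕ.≤ m → ι c ℚ.< seq ρ m ℚ.+ θ) →
        ∃[ N ] ∀ m → N ℕ.≤ m → ℚ.∣ seq (x i) m ℚ.- 0ℚ ∣ ℚ.< ε
      -- The contraction is applied with T the sum of all |x j| at index m and e = θ Z; the entry in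
      -- question is then bounded by T.
      combine-bounds (N₁ , close) (N₂ , big) = N₁ ℕ.⊔ N₂ , λ m le →
        contraction⇒small _ _ ε (seq (x i) m) (sum-nonNeg (λ j → ℚ.0≤∣p∣ (seq (x j) m)))
          (sum-bound {c} {z} sub (λ j → ℚ.∣ seq (x j) m ∣) (λ j → ℚ.0≤∣p∣ (seq (x j) m)) θ (ℚ.<⇒≤ 0<θ)
            (super {ρ} {c} {x} m θ (close m (ℕ.m⊔n≤o⇒m≤o N₁ N₂ le)) (big m (ℕ.m⊔n≤o⇒n≤o N₁ N₂ le))))
          θZ< (term≤sum (λ j → ℚ.0≤∣p∣ (seq (x j) m)) i)

-- Test vectors

module _ {n : ℕ} where
  open DecMembership (Fin._≟_ {n}) public using (_∈?_)

deg : ∀ {n} → Graph (Fin n) → Fin n → ℕ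
deg {n} G = degIn G (allFin n)

module _ {n : ℕ} (G : Graph (Fin n)) {S B : List (Fin n)} (split : allFin n ↭ S ++ B) where

  private
    ∈S⊎∈B : ∀ i → i ∈ S ⊎ i ∈ B
    ∈S⊎∈B i = ∈-++⁻ S (Perm.∈-resp-↭ split (∈-allFin i))

    B∩S=∅ : ∀ {i} → i ∈ B → i ∉ S
    B∩S=∅ i∈B i∈S = Unique-++-disjoint S (Unique-↭ split (allFin⁺ n)) i∈S i∈B refl

    |S|+|B| : length S +ℕ length B ≡ n
    |S|+|B| = trans (sym (length-++ S)) (trans (sym (Perm.↭-length split)) (length-tabulate id))

    entry-≤ : ∀ b m → (if b then m else 0) ≤ m
    entry-≤ true  m = ℕ.≤-refl
    entry-≤ false m = z≤n

    entry-* : ∀ b m → (if b then m else 0) ≡ m * ind b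
    entry-* true  m = sym (ℕ.*-identityʳ m)
    entry-* false m = sym (ℕ.*-zeroʳ m)

  weightedDegree-split : ∀ z i → weightedDegree G z i ≡
    ∑ˡ (λ j → if adj G i j then z j else 0) S +ℕ ∑ˡ (λ j → if adj G i j then z j else 0) B
  weightedDegree-split z i = trans (∑ˡ-↭ _ split) (∑ˡ-++ _ S B)

  weightedDegree-≤ : ∀ z i {M} → (∀ j → z j ≤ M) → weightedDegree G z i ≤ M * deg G i
  weightedDegree-≤ z i {M} z≤M = begin
    ∑ˡ (λ j → if adj G i j then z j else 0) (allFin n)
      ≤⟨ ∑ˡ-mono (allFin n) (λ {j} _ → ℕ.≤-trans (ℕ.≤-reflexive (entry-* (adj G i j) (z j))) (ℕ.*-monoˡ-≤ _ (z≤M j))) ⟩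
    ∑ˡ (λ j → M * ind (adj G i j)) (allFin n)
      ≡⟨ ∑ˡ-* M (ind ∘ adj G i) (allFin n) ⟩
    M * deg G i ∎
    where open ℕ.≤-Reasoning

  -- The weights are α on S and p elsewhere, in total (c + t + 1) p - |S| (p - α). A row outside S
  -- lacks its own p, so it stays below c p as soon as the deficit |S| (p - α) exceeds t p. A row in
  -- S is at most p times its degree.
  lowDegreeTestVector : ∀ {c t α p} → c +ℕ suc t ≡ n → α ≤ p →
    (∀ {s} → s ∈ S → p * deg G s < c * α) → length S * α +ℕ t * p < length S * p →
    ∃[ z ] TestVector G c z
  lowDegreeTestVector {c} {t} {α} {p} c+t+1 α≤p low few = z , sub
    where
    z : Fin n → ℕ
    z i = if does (i ∈? S) then α else p
    z-S : ∀ {i} → i ∈ S → z i ≡ α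
    z-S {i} i∈ rewrite dec-true (i ∈? S) i∈ = refl
    z-B : ∀ {i} → i ∈ B → z i ≡ p
    z-B {i} i∈ rewrite dec-false (i ∈? S) (B∩S=∅ i∈) = refl
    z≤p : ∀ i → z i ≤ p
    z≤p i with does (i ∈? S)
    ... | true  = α≤p
    ... | false = ℕ.≤-refl
    total : ∑ˡ z (allFin n) ≡ length S * α +ℕ length B * p
    total = trans (∑ˡ-↭ z split) (trans (∑ˡ-++ z S B) (cong₂ _+ℕ_
      (trans (∑ˡ-cong S z-S) (∑ˡ-const α S)) (trans (∑ˡ-cong B z-B) (∑ˡ-const p B))))
    open ℕ.≤-Reasoning
    open ℕ-Solver
    sub : TestVector G c z
    sub i with ∈S⊎∈B i
    ... | inj₁ i∈ = begin-strict
      weightedDegree G z i ≤⟨ weightedDegree-≤ z i z≤p ⟩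
      p * deg G i          <⟨ low i∈ ⟩
      c * α                ≡⟨ cong (c *_) (z-S i∈) ⟨
      c * z i              ∎
    ... | inj₂ i∈ = ℕ.+-cancelʳ-< (p +ℕ t * p) _ _ (begin-strict
      weightedDegree G z i +ℕ (p +ℕ t * p)
        ≡⟨ ℕ.+-assoc (weightedDegree G z i) p (t * p) ⟨
      weightedDegree G z i +ℕ p +ℕ t * p
        ≤⟨ ℕ.+-monoˡ-≤ (t * p) (∑ˡ-slack (allFin n) (∈-allFin i) (λ {j} _ → entry-≤ (adj G i j) (z j)) self) ⟩
      ∑ˡ z (allFin n) +ℕ t * p
        ≡⟨ cong (_+ℕ t * p) total ⟩
      length S * α +ℕ length B * p +ℕ t * p
        ≡⟨ solve 3 (λ a b c → a :+ b :+ c := (a :+ c) :+ b) refl (length S * α) (length B * p) (t * p) ⟩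
      length S * α +ℕ t * p +ℕ length B * p
        <⟨ ℕ.+-monoˡ-< (length B * p) few ⟩
      length S * p +ℕ length B * p
        ≡⟨ ℕ.*-distribʳ-+ p (length S) (length B) ⟨
      (length S +ℕ length B) * p
        ≡⟨ cong (_* p) (trans |S|+|B| (sym c+t+1)) ⟩
      (c +ℕ suc t) * p
        ≡⟨ ℕ.*-distribʳ-+ p c (suc t) ⟩
      c * p +ℕ (p +ℕ t * p)
        ≡⟨ cong (λ q → c * q +ℕ (p +ℕ t * p)) (z-B i∈) ⟨
      c * z i +ℕ (p +ℕ t * p) ∎)
      where
      self : (if adj G i i then z i else 0) +ℕ p ≤ z i
      self rewrite loopless G i = ℕ.≤-reflexive (sym (z-B i∈))

  -- B would carry weight 1 if it were a clique; the missing edge u v allows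
  -- perturbing u and v down and the attachments of S up, which leaves room
  -- for weights of order 1/c on S.  Everything is scaled by (c+1)δt.
  missingEdgeTestVector : ∀ {c t δ u v} (w : Fin n → Bool) →
    1 ≤ t → 1 ≤ δ → δ * suc (δ * t) < c → length S ≡ t → length B ≡ suc c →
    (∀ {s} → s ∈ S → deg G s ≤ δ) → count w B ≤ δ →
    (∀ {b s} → b ∈ B → s ∈ S → w b ≡ false → adj G b s ≡ false) →
    u ∈ B → v ∈ B → u ≢ v → adj G u v ≡ false →
    ∃[ z ] TestVector G c z
  missingEdgeTestVector {c} {t} {δ} {u} {v} w 1≤t 1≤δ large |S| |B| degS |w| wS u∈ v∈ u≢v uv = z , sub
    where
    -- Adding z b to both sides of a row turns the factor c into N, the size of B, and the row into
    -- a sum over all of B. The attachments add at most δ t = h to that sum, while u and v each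
    -- forgo a bonus h, so h is left over. An attached vertex sees at most t vertices of weight N in
    -- S, which its own extra t, multiplied by N, repays. At u and v the row also lacks the other
    -- endpoint, of weight at least p, and this covers the forgone bonus exactly when p > c h.
    N h p : ℕ
    N = suc c
    h = δ * t
    p = c * h +ℕ 1
    bonus : Fin n → ℕ
    bonus i = if does (i Fin.≟ u) then 0 else if does (i Fin.≟ v) then 0 else h
    zB g : Fin n → ℕ
    zB i = p +ℕ t * ind (w i) +ℕ bonus i
    g i = p +ℕ h +ℕ t * ind (w i)
    z : Fin n → ℕ
    z i = if does (i ∈? S) then N else zB i
    z-S : ∀ {i} → i ∈ S → z i ≡ N
    z-S {i} i∈ rewrite dec-true (i ∈? S) i∈ = refl
    z-B : ∀ {i} → i ∈ B → z i ≡ zB i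
    z-B {i} i∈ rewrite dec-false (i ∈? S) (B∩S=∅ i∈) = refl
    bonus-u : bonus u ≡ 0
    bonus-u rewrite dec-true (u Fin.≟ u) refl = refl
    bonus-v : bonus v ≡ 0
    bonus-v rewrite dec-false (v Fin.≟ u) (u≢v ∘ sym) | dec-true (v Fin.≟ v) refl = refl
    bonus-else : ∀ {i} → i ≢ u → i ≢ v → bonus i ≡ h
    bonus-else {i} i≢u i≢v rewrite dec-false (i Fin.≟ u) i≢u | dec-false (i Fin.≟ v) i≢v = refl
    bonus≤h : ∀ i → bonus i ≤ h
    bonus≤h i with does (i Fin.≟ u) | does (i Fin.≟ v)
    ... | true  | _     = z≤n
    ... | false | true  = z≤n
    ... | false | false = ℕ.≤-refl
    1≤h : 1 ≤ h
    1≤h = ℕ.*-mono-≤ 1≤δ 1≤t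
    open ℕ.≤-Reasoning
    open ℕ-Solver

    zB+≤g : ∀ i e → bonus i +ℕ e ≤ h → zB i +ℕ e ≤ g i
    zB+≤g i e le = begin
      p +ℕ t * ind (w i) +ℕ bonus i +ℕ e   ≡⟨ ℕ.+-assoc (p +ℕ t * ind (w i)) (bonus i) e ⟩
      p +ℕ t * ind (w i) +ℕ (bonus i +ℕ e) ≤⟨ ℕ.+-monoʳ-≤ (p +ℕ t * ind (w i)) le ⟩
      p +ℕ t * ind (w i) +ℕ h
        ≡⟨ solve 3 (λ p x h → p :+ x :+ h := p :+ h :+ x) refl p (t * ind (w i)) h ⟩
      g i                               ∎

    ∑B : ∑ˡ z B +ℕ h ≤ N * (p +ℕ h)
    ∑B = ℕ.+-cancelʳ-≤ h _ _ (begin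
      ∑ˡ z B +ℕ h +ℕ h                   ≤⟨ ∑ˡ-slack₂ B u∈ v∈ u≢v
        (λ {i} i∈ → subst (_≤ g i) (trans (ℕ.+-identityʳ (zB i)) (sym (z-B i∈)))
          (zB+≤g i 0 (subst (_≤ h) (sym (ℕ.+-identityʳ (bonus i))) (bonus≤h i))))
        (subst (λ q → q +ℕ h ≤ g u) (sym (z-B u∈)) (zB+≤g u h (ℕ.≤-reflexive (cong (_+ℕ h) bonus-u))))
        (subst (λ q → q +ℕ h ≤ g v) (sym (z-B v∈)) (zB+≤g v h (ℕ.≤-reflexive (cong (_+ℕ h) bonus-v)))) ⟩
      ∑ˡ g B                           ≡⟨ ∑ˡ-+ (λ _ → p +ℕ h) (λ i → t * ind (w i)) B ⟩
      ∑ˡ (λ _ → p +ℕ h) B +ℕ ∑ˡ (λ i → t * ind (w i)) B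
                                       ≡⟨ cong₂ _+ℕ_ (∑ˡ-const (p +ℕ h) B) (∑ˡ-* t (ind ∘ w) B) ⟩
      length B * (p +ℕ h) +ℕ t * count w B
        ≤⟨ ℕ.+-mono-≤ (ℕ.≤-reflexive (cong (_* (p +ℕ h)) |B|)) (ℕ.*-monoʳ-≤ t |w|) ⟩
      N * (p +ℕ h) +ℕ t * δ              ≡⟨ cong (N * (p +ℕ h) +ℕ_) (ℕ.*-comm t δ) ⟩
      N * (p +ℕ h) +ℕ h                  ∎)

    ∑S : ∀ {b} → b ∈ B → ∑ˡ (λ j → if adj G b j then z j else 0) S ≤ N * (t * ind (w b))
    ∑S {b} b∈ with w b in wb
    ... | false = ℕ.≤-trans (ℕ.≤-reflexive (trans (∑ˡ-cong S (λ {j} s∈ → cong (if_then z j else 0) (wS b∈ s∈ wb)))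
                    (trans (∑ˡ-const 0 S) (ℕ.*-zeroʳ (length S))))) z≤n
    ... | true  = begin
      ∑ˡ (λ j → if adj G b j then z j else 0) S
        ≤⟨ ∑ˡ-mono S (λ {j} s∈ → ℕ.≤-trans (entry-≤ (adj G b j) (z j)) (ℕ.≤-reflexive (z-S s∈))) ⟩
      ∑ˡ (λ _ → N) S     ≡⟨ ∑ˡ-const N S ⟩
      length S * N       ≡⟨ cong (_* N) |S| ⟩
      t * N              ≡⟨ solve 2 (λ t N → t :* N := N :* (t :* con 1)) refl t N ⟩
      N * (t * 1)        ∎

    z≤max : ∀ i → z i ≤ N * suc h
    z≤max i with does (i ∈? S)
    ... | true  = ℕ.m≤m*n N (suc h)
    ... | false = begin
      p +ℕ t * ind (w i) +ℕ bonus i ≤⟨ ℕ.+-mono-≤ (ℕ.+-monoʳ-≤ p (ℕ.*-monoʳ-≤ t (ind≤1 (w i)))) (bonus≤h i) ⟩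
      p +ℕ t * 1 +ℕ h               ≤⟨ ℕ.+-monoˡ-≤ h (ℕ.+-monoʳ-≤ p t≤c) ⟩
      p +ℕ c +ℕ h
        ≡⟨ solve 2 (λ c h → c :* h :+ con 1 :+ c :+ h := (con 1 :+ c) :* (con 1 :+ h)) refl c h ⟩
      N * suc h                   ∎
      where
      t≤c : t * 1 ≤ c
      t≤c = begin
        t * 1          ≡⟨ ℕ.*-identityʳ t ⟩
        t              ≡⟨ ℕ.*-identityˡ t ⟨
        1 * t          ≤⟨ ℕ.*-monoˡ-≤ t 1≤δ ⟩
        h              ≤⟨ ℕ.n≤1+n h ⟩
        suc h          ≡⟨ ℕ.*-identityˡ (suc h) ⟨
        1 * suc h      ≤⟨ ℕ.*-monoˡ-≤ (suc h) 1≤δ ⟩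
        δ * suc h      ≤⟨ ℕ.<⇒≤ large ⟩
        c              ∎

    self : ∀ i e → z i ≡ e → (if adj G i i then z i else 0) +ℕ e ≤ z i
    self i e eq rewrite loopless G i = ℕ.≤-reflexive (sym eq)

    nonadjacent : ∀ {i j} → adj G i j ≡ false → (if adj G i j then z j else 0) +ℕ z j ≤ z j
    nonadjacent eq rewrite eq = ℕ.≤-refl

    row : ∀ {b} → b ∈ B → weightedDegree G z b +ℕ z b < N * z b → weightedDegree G z b < c * z b
    row {b} b∈ h′ = ℕ.+-cancelʳ-< (z b) _ _ (subst (weightedDegree G z b +ℕ z b <_) (ℕ.+-comm (z b) (c * z b)) h′)

    generic : ∀ {b} → b ∈ B → b ≢ u → b ≢ v → weightedDegree G z b +ℕ z b < N * z b
    generic {b} b∈ b≢u b≢v = ℕ.+-cancelʳ-< h _ _ (begin-strict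
      weightedDegree G z b +ℕ z b +ℕ h
        ≡⟨ cong (λ q → q +ℕ z b +ℕ h) (weightedDegree-split z b) ⟩
      (σS +ℕ σB) +ℕ z b +ℕ h
        ≡⟨ solve 4 (λ a b c d → a :+ b :+ c :+ d := a :+ ((b :+ c) :+ d)) refl σS σB (z b) h ⟩
      σS +ℕ (σB +ℕ z b +ℕ h)
        ≤⟨ ℕ.+-mono-≤ (∑S b∈) (ℕ.≤-trans (ℕ.+-monoˡ-≤ h (∑ˡ-slack B b∈ (λ {j} _ → entry-≤ (adj G b j) (z j)) (self b (z b) refl))) ∑B) ⟩
      N * (t * ind (w b)) +ℕ N * (p +ℕ h)
        <⟨ ℕ.≤-trans (ℕ.≤-reflexive (ℕ.+-comm 1 _)) (ℕ.+-monoʳ-≤ _ 1≤h) ⟩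
      N * (t * ind (w b)) +ℕ N * (p +ℕ h) +ℕ h
        ≡⟨ cong (_+ℕ h) (solve 4 (λ N x p h → N :* x :+ N :* (p :+ h) := N :* (p :+ x :+ h)) refl N (t * ind (w b)) p h) ⟩
      N * (p +ℕ t * ind (w b) +ℕ h) +ℕ h
        ≡⟨ cong (λ q → N * q +ℕ h) (trans (z-B b∈) (cong (p +ℕ t * ind (w b) +ℕ_) (bonus-else b≢u b≢v))) ⟨
      N * z b +ℕ h ∎)
      where
      σS = ∑ˡ (λ j → if adj G b j then z j else 0) S
      σB = ∑ˡ (λ j → if adj G b j then z j else 0) B

    endpoint : ∀ {b b′} → b ∈ B → b′ ∈ B → b ≢ b′ → adj G b b′ ≡ false → bonus b ≡ 0 →
      weightedDegree G z b +ℕ z b < N * z b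
    endpoint {b} {b′} b∈ b′∈ b≢b′ bb′ bonus-b = ℕ.+-cancelʳ-< (N * h) _ _ (begin-strict
      weightedDegree G z b +ℕ z b +ℕ N * h
        <⟨ ℕ.≤-refl ⟩
      suc (weightedDegree G z b +ℕ z b +ℕ N * h)
        ≡⟨ cong (λ q → suc (q +ℕ z b +ℕ N * h)) (weightedDegree-split z b) ⟩
      suc (σS +ℕ σB +ℕ z b +ℕ N * h)
        ≡⟨ solve 5 (λ a b c d e → con 1 :+ (a :+ b :+ c :+ (con 1 :+ d) :* e) := a :+ ((b :+ c :+ (d :* e :+ con 1)) :+ e)) refl σS σB (z b) c h ⟩
      σS +ℕ (σB +ℕ z b +ℕ p +ℕ h)
        ≤⟨ ℕ.+-monoʳ-≤ σS (ℕ.+-monoˡ-≤ h (ℕ.+-monoʳ-≤ (σB +ℕ z b) p≤z)) ⟩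
      σS +ℕ (σB +ℕ z b +ℕ z b′ +ℕ h)
        ≤⟨ ℕ.+-mono-≤ (∑S b∈) (ℕ.≤-trans (ℕ.+-monoˡ-≤ h (∑ˡ-slack₂ B b∈ b′∈ b≢b′ (λ {j} _ → entry-≤ (adj G b j) (z j)) (self b (z b) refl) (nonadjacent bb′))) ∑B) ⟩
      N * (t * ind (w b)) +ℕ N * (p +ℕ h)
        ≡⟨ solve 4 (λ N x p h → N :* x :+ N :* (p :+ h) := N :* (p :+ x :+ con 0) :+ N :* h) refl N (t * ind (w b)) p h ⟩
      N * (p +ℕ t * ind (w b) +ℕ 0) +ℕ N * h
        ≡⟨ cong (λ q → N * q +ℕ N * h) (trans (z-B b∈) (cong (p +ℕ t * ind (w b) +ℕ_) bonus-b)) ⟨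
      N * z b +ℕ N * h ∎)
      where
      σS = ∑ˡ (λ j → if adj G b j then z j else 0) S
      σB = ∑ˡ (λ j → if adj G b j then z j else 0) B
      p≤z : p ≤ z b′
      p≤z = subst (p ≤_) (sym (z-B b′∈)) (ℕ.≤-trans (ℕ.m≤m+n p (t * ind (w b′))) (ℕ.m≤m+n _ (bonus b′)))

    sub : TestVector G c z
    sub i with ∈S⊎∈B i
    ... | inj₁ i∈ = begin-strict
      weightedDegree G z i ≤⟨ weightedDegree-≤ z i z≤max ⟩
      N * suc h * deg G i  ≤⟨ ℕ.*-monoʳ-≤ (N * suc h) (degS i∈) ⟩
      N * suc h * δ        ≡⟨ solve 3 (λ N h δ → N :* h :* δ := (δ :* h) :* N) refl N (suc h) δ ⟩
      δ * suc h * N        <⟨ ℕ.*-monoˡ-< N large ⟩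
      c * N                ≡⟨ cong (c *_) (z-S i∈) ⟨
      c * z i              ∎
    ... | inj₂ i∈ = row i∈ (byCase (i Fin.≟ u) (i Fin.≟ v))
      where
      byCase : Dec (i ≡ u) → Dec (i ≡ v) → weightedDegree G z i +ℕ z i < N * z i
      byCase (yes refl) _          = endpoint i∈ v∈ u≢v uv bonus-u
      byCase (no _)     (yes refl) = endpoint i∈ u∈ (u≢v ∘ sym) (trans (symmetric G v u) uv) bonus-v
      byCase (no i≢u)   (no i≢v)   = generic i∈ i≢u i≢v

-- Graphs with a non-Hamiltonian induced subgraph

≤-squeeze : ∀ {a b k t} → a ≤ k → b ≤ t → t +ℕ k ≤ a +ℕ b → a ≡ k × b ≡ t
≤-squeeze {a} {b} {k} {t} a≤k b≤t h =
  ℕ.≤-antisym a≤k (ℕ.+-cancelˡ-≤ t _ _ (ℕ.≤-trans h (ℕ.≤-trans (ℕ.+-monoʳ-≤ a b≤t) (ℕ.≤-reflexive (ℕ.+-comm a t))))) ,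
  ℕ.≤-antisym b≤t (ℕ.+-cancelʳ-≤ k _ _ (ℕ.≤-trans h (ℕ.≤-trans (ℕ.+-monoˡ-≤ b a≤k) (ℕ.≤-reflexive (ℕ.+-comm k b)))))

module _ {V : Set} (_≟_ : DecidableEquality V) (M : Graph V) where
  open BondyChvátal _≟_

  -- Deleting τ and R leaves S and the j − 1 vertices of C = v ∷ T; there Ore's
  -- condition holds, and τ and R are inserted into the cycle next to v.
  absorb : ∀ S τ v T R → Unique (S ++ (τ ∷ v ∷ T) ++ R) →
    (∀ {s b} → s ∈ S → b ∈ τ ∷ v ∷ T → adj M s b ≡ true) →
    (∀ {b b′} → b ∈ (τ ∷ v ∷ T) ++ R → b′ ∈ (τ ∷ v ∷ T) ++ R → b ≢ b′ → adj M b b′ ≡ true) →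
    (∀ {s} → s ∈ S → length S ≤ count (adj M s) S +ℕ (2 +ℕ length T)) → 2 +ℕ length T < length S →
    HamCycle M (S ++ (τ ∷ v ∷ T) ++ R)
  absorb S τ v T R uniq joined clique degS j<t = insert (rotate cycleQ (∈-++⁺ʳ S (here refl)))
    where
    C = v ∷ T
    Q = S ++ C
    perm : Q ++ τ ∷ R ↭ S ++ (τ ∷ C) ++ R
    perm = ↭-trans (↭-reflexive (++-assoc S C (τ ∷ R))) (Perm.++⁺ˡ S (Perm.shift τ C R))
    uniq′ : Unique (Q ++ τ ∷ R)
    uniq′ = Unique-↭ (↭-sym perm) uniq
    uniqQ : Unique Q
    uniqQ = Unique-++⁻ˡ Q uniq′
    |Q| : length Q ≡ length S +ℕ (1 +ℕ length T)
    |Q| = length-++ S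
    3≤Q : 3 ≤ length Q
    3≤Q = ℕ.≤-trans (ℕ.≤-trans (s≤s (s≤s (s≤s z≤n))) j<t) (subst (length S ≤_) (sym |Q|) (ℕ.m≤m+n (length S) _))
    open Closure (closure M uniqQ 3≤Q) renaming (graph to M′)
    B : List V
    B = (τ ∷ C) ++ R
    C⊆B : ∀ {x} → x ∈ C → x ∈ B
    C⊆B x∈ = there (∈-++⁺ˡ x∈)
    τR⊆B : ∀ {x} → x ∈ τ ∷ R → x ∈ B
    τR⊆B (here eq) = here eq
    τR⊆B (there x∈) = there (∈-++⁺ʳ C x∈)
    degQ : ∀ {s} → s ∈ S → length S ≤ suc (degIn M′ Q s)
    degQ {s} s∈ = begin
      length S                                ≤⟨ degS s∈ ⟩
      count (adj M s) S +ℕ (2 +ℕ length T)      ≡⟨ ℕ.+-suc _ _ ⟩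
      suc (count (adj M s) S +ℕ length C)
        ≡⟨ cong (λ m → suc (count (adj M s) S +ℕ m)) (count-all (adj M s) C (λ b∈ → joined s∈ (there b∈))) ⟨
      suc (count (adj M s) S +ℕ count (adj M s) C) ≡⟨ cong suc (count-++ (adj M s) S C) ⟨
      suc (count (adj M s) Q)                 ≤⟨ s≤s (count-mono Q (λ _ → extends)) ⟩
      suc (degIn M′ Q s)                      ∎
      where open ℕ.≤-Reasoning
    complete : ∀ {x y} → x ∈ Q → y ∈ Q → x ≢ y → adj M′ x y ≡ true
    complete {x} {y} x∈ y∈ x≢y with ∈-++⁻ S x∈ | ∈-++⁻ S y∈
    ... | inj₂ x∈C | inj₂ y∈C = extends (clique (C⊆B x∈C) (C⊆B y∈C) x≢y)
    ... | inj₁ x∈S | inj₂ y∈C = extends (joined x∈S (there y∈C))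
    ... | inj₂ x∈C | inj₁ y∈S = extends (adj-sym M (joined y∈S (there x∈C)))
    -- Each of x and y has degree at least |S| - 1 in Q. With j = 2 + |T| < |S|, the size |Q| = |S|
    -- + j - 1 is at most 2 (|S| - 1), so closedness leaves no nonadjacent pair.
    ... | inj₁ x∈S | inj₁ y∈S = ≢false⇒true λ e → ℕ.<-irrefl refl (begin-strict
      length S +ℕ length S                       ≤⟨ ℕ.+-mono-≤ (degQ x∈S) (degQ y∈S) ⟩
      suc (degIn M′ Q x) +ℕ suc (degIn M′ Q y)   ≡⟨ cong suc (ℕ.+-suc _ _) ⟩
      2 +ℕ (degIn M′ Q x +ℕ degIn M′ Q y)         <⟨ s≤s (s≤s (closed x∈ y∈ x≢y e)) ⟩
      2 +ℕ length Q                              ≡⟨ cong (2 +ℕ_) |Q| ⟩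
      2 +ℕ (length S +ℕ (1 +ℕ length T))
        ≡⟨ solve 2 (λ s t → con 2 :+ (s :+ (con 1 :+ t)) := s :+ (con 3 :+ t)) refl (length S) (length T) ⟩
      length S +ℕ (3 +ℕ length T)                 ≤⟨ ℕ.+-monoʳ-≤ (length S) j<t ⟩
      length S +ℕ length S                       ∎)
      where
      open ℕ.≤-Reasoning
      open ℕ-Solver
    cycleQ : HamCycle M Q
    cycleQ = reflects (cliqueCycle M′ Q uniqQ (ℕ.<⇒≤ 3≤Q) complete)
    -- Whatever vertex y precedes v on the cycle, it is adjacent to τ, which is joined to S and to
    -- the rest of the clique. So the edge y v can be replaced by a detour through τ and R, which
    -- returns to v inside the clique.
    insert : ∃[ xs ] ∃[ y ] (Path M v xs y × adj M y v ≡ true × v ∷ xs ↭ Q) → HamCycle M (S ++ B)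
    insert (xs , y , p , _ , r) with cliquePath M τ R (Unique-++⁻ʳ Q uniq′)
                                      (λ b∈ b′∈ → clique (τR⊆B b∈) (τR⊆B b′∈))
    ... | z , q = v , xs ++ τ ∷ R , z , join p y~τ q , z~v , ↭-trans (Perm.++⁺ʳ (τ ∷ R) r) perm
      where
      y∈Q : y ∈ Q
      y∈Q = Perm.∈-resp-↭ r (end∈ p)
      y~τ : adj M y τ ≡ true
      y~τ with ∈-++⁻ S y∈Q
      ... | inj₁ y∈S = joined y∈S (here refl)
      ... | inj₂ y∈C = clique (C⊆B y∈C) (here refl) (Unique-++-disjoint Q uniq′ y∈Q (here refl))
      z~v : adj M z v ≡ true
      z~v = clique (τR⊆B (end∈ q)) (there (here refl))
        (Unique-++-disjoint Q uniq′ (∈-++⁺ʳ S (here refl)) (end∈ q) ∘ sym)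

-- `W` will be X together with the j attachments of S, so |W| = k + j. The constructors are the
-- cases j = t and j = 1.
data Shape {n} (G : Graph (Fin n)) (k δ : ℕ) (S W : List (Fin n)) : Set where
  independent : length W ≡ δ → (∀ {s s′} → s ∈ S → s′ ∈ S → adj G s s′ ≡ false) → Shape G k δ S W
  clique : length W ≡ k +ℕ 1 → (∀ {s s′} → s ∈ S → s′ ∈ S → s ≢ s′ → adj G s s′ ≡ true) → Shape G k δ S W

-- Every adjacency with an end in S is fixed here, while edges inside `W ++ R` are left open: the
-- closure may have added some there. The bound `degS` is what the test vector for a missing edge
-- asks for.
record Extremal {n} (G : Graph (Fin n)) (t k δ : ℕ) : Set where
  field
    S W R    : List (Fin n)
    split    : allFin n ↭ S ++ (W ++ R)
    |S|≡t    : length S ≡ t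
    degS     : ∀ {s} → s ∈ S → deg G s ≤ δ
    S–W      : ∀ {s b} → s ∈ S → b ∈ W → adj G s b ≡ true
    S–R      : ∀ {s b} → s ∈ S → b ∈ R → adj G s b ≡ false
    shape    : Shape G k δ S W

module _ {n : ℕ} (G : Graph (Fin n)) {c t k δ : ℕ} (n≡ : c +ℕ suc t ≡ n) (δ≡ : t +ℕ k ≡ δ)
  (minDeg : ∀ v → δ ≤ deg G v) (spec : ∀ z → ¬ TestVector G c z)
  (c≥₁ : 6 * k +ℕ 3 * t +ℕ 3 ≤ c) (c≥₂ : k +ℕ 6 * t ≤ c) (c≥₃ : (t +ℕ 2) * (k +ℕ 3 * t) < c)
  {X vs : List (Fin n)} (splitX : allFin n ↭ X ++ vs) (|X|≤k : length X ≤ k) where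

  open BondyChvátal (Fin._≟_ {n})
  open ℕ.≤-Reasoning
  open ℕ-Solver

  private
    N = length vs

    |X|+N : length X +ℕ N ≡ n
    |X|+N = trans (sym (length-++ X)) (trans (sym (Perm.↭-length splitX)) (length-tabulate id))

    c<k+N : c < k +ℕ N
    c<k+N = begin-strict
      c            <⟨ ℕ.m<m+n c (s≤s z≤n) ⟩
      c +ℕ suc t    ≡⟨ trans n≡ (sym |X|+N) ⟩
      length X +ℕ N ≤⟨ ℕ.+-monoˡ-≤ N |X|≤k ⟩
      k +ℕ N        ∎

  3≤|vs| : 3 ≤ length vs
  3≤|vs| = ℕ.+-cancelˡ-≤ k _ _ (begin
    k +ℕ 3                    ≤⟨ ℕ.+-monoˡ-≤ 3 (ℕ.≤-trans (ℕ.m≤m+n k _) (ℕ.m≤m+n (6 * k) (3 * t))) ⟩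
    6 * k +ℕ 3 * t +ℕ 3        ≤⟨ ℕ.≤-trans c≥₁ (ℕ.<⇒≤ c<k+N) ⟩
    k +ℕ N                    ∎)

  private
    6t≤N : 6 * t ≤ N
    6t≤N = ℕ.+-cancelˡ-≤ k _ _ (ℕ.≤-trans c≥₂ (ℕ.<⇒≤ c<k+N))

    uniq : Unique vs
    uniq = Unique-++⁻ʳ X (Unique-↭ splitX (allFin⁺ n))

  module FromClosure (cl : Closure G vs) where
    open Closure cl renaming (graph to M)

    d : Fin n → ℕ
    d = degIn M vs

    low? : (v : Fin n) → Dec (2 * d v < N)
    low? v = 2 * d v ℕ.<? N

    S B : List (Fin n)
    S = filter low? vs
    B = filter (¬? ∘ low?) vs

    splitS : vs ↭ S ++ B
    splitS = filter-split low? vs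

    |S|+|B| : N ≡ length S +ℕ length B
    |S|+|B| = trans (Perm.↭-length splitS) (length-++ S)

    uniqSB : Unique (S ++ B)
    uniqSB = Unique-↭ splitS uniq

    S⊆vs : ∀ {s} → s ∈ S → s ∈ vs
    S⊆vs s∈ = proj₁ (∈-filter⁻ low? s∈)

    B⊆vs : ∀ {b} → b ∈ B → b ∈ vs
    B⊆vs b∈ = proj₁ (∈-filter⁻ (¬? ∘ low?) {xs = vs} b∈)

    low : ∀ {s} → s ∈ S → 2 * d s < N
    low s∈ = proj₂ (∈-filter⁻ low? {xs = vs} s∈)

    high : ∀ {b} → b ∈ B → N ≤ 2 * d b
    high b∈ = ℕ.≮⇒≥ (proj₂ (∈-filter⁻ (¬? ∘ low?) {xs = vs} b∈))

    degG : ∀ v → deg G v ≡ count (adj G v) X +ℕ degIn G vs v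
    degG v = trans (count-↭ (adj G v) splitX) (count-++ (adj G v) X vs)

    degIn≤d : ∀ v → degIn G vs v ≤ d v
    degIn≤d v = count-mono vs (λ _ → extends)

    degG≤ : ∀ v → deg G v ≤ k +ℕ d v
    degG≤ v = subst (_≤ k +ℕ d v) (sym (degG v))
      (ℕ.+-mono-≤ (ℕ.≤-trans (count≤length (adj G v) X) |X|≤k) (degIn≤d v))

    d-split : ∀ v → d v ≡ count (adj M v) S +ℕ count (adj M v) B
    d-split v = trans (count-↭ (adj M v) splitS) (count-++ (adj M v) S B)

    cliqueB : ∀ {b b′} → b ∈ B → b′ ∈ B → b ≢ b′ → adj M b b′ ≡ true
    cliqueB {b} {b′} b∈ b′∈ b≢b′ = ≢false⇒true λ e → ℕ.<-irrefl refl (begin-strict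
      2 * (d b +ℕ d b′)    <⟨ ℕ.*-monoʳ-< 2 (closed (B⊆vs b∈) (B⊆vs b′∈) b≢b′ e) ⟩
      2 * N               ≡⟨ solve 1 (λ n → con 2 :* n := n :+ n) refl N ⟩
      N +ℕ N               ≤⟨ ℕ.+-mono-≤ (high b∈) (high b′∈) ⟩
      2 * d b +ℕ 2 * d b′  ≡⟨ ℕ.*-distribˡ-+ 2 (d b) (d b′) ⟨
      2 * (d b +ℕ d b′)    ∎)

    |B|≤ : ∀ {b} → b ∈ B → length B ≤ 1 +ℕ count (adj M b) B
    |B|≤ {b} b∈ = length≤1+count (adj M b) B (Unique-++⁻ʳ S uniqSB) b∈ (λ x∈ x≢b → cliqueB b∈ x∈ (x≢b ∘ sym))

    S~B : ∀ {s b} → s ∈ S → b ∈ B → N ≤ d b +ℕ d s → adj M s b ≡ true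
    S~B {s} {b} s∈ b∈ h = ≢false⇒true λ e → ℕ.<⇒≱
      (closed (S⊆vs s∈) (B⊆vs b∈) (Unique-++-disjoint S uniqSB s∈ b∈) e) (subst (N ≤_) (ℕ.+-comm (d b) (d s)) h)

    -- A vertex of S with more than |S| neighbours would be joined to all of B.
    d≤|S| : 2 * length S ≤ N → ∀ {s} → s ∈ S → d s ≤ length S
    d≤|S| 2|S|≤N {s} s∈ = ℕ.≮⇒≥ λ |S|<d → ℕ.<-irrefl refl (begin-strict
      N +ℕ N                             ≡⟨ cong₂ _+ℕ_ |S|+|B| |S|+|B| ⟩
      (length S +ℕ length B) +ℕ (length S +ℕ length B)
                                        ≡⟨ solve 2 (λ a b → (a :+ b) :+ (a :+ b) := con 2 :* a :+ con 2 :* b) refl (length S) (length B) ⟩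
      2 * length S +ℕ 2 * length B       ≤⟨ ℕ.+-mono-≤ 2|S|≤N (ℕ.*-monoʳ-≤ 2 (|B|≤d |S|<d)) ⟩
      N +ℕ 2 * d s                       <⟨ ℕ.+-monoʳ-< N (low s∈) ⟩
      N +ℕ N                             ∎)
      where
      |B|≤d : length S < d s → length B ≤ d s
      |B|≤d |S|<d = begin
        length B            ≡⟨ count-all (adj M s) B (λ {b} b∈ → S~B s∈ b∈ (enough b∈)) ⟨
        count (adj M s) B   ≤⟨ ℕ.m≤n+m _ (count (adj M s) S) ⟩
        count (adj M s) S +ℕ count (adj M s) B ≡⟨ d-split s ⟨
        d s                 ∎
        where
        -- In the clique B the vertex b misses only itself, so d b ≥ |B| - 1, and d s ≥ |S| + 1
        -- lifts the sum to N.
        enough : ∀ {b} → b ∈ B → N ≤ d b +ℕ d s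
        enough {b} b∈ = ℕ.≤-pred (begin
          suc N                               ≡⟨ cong suc (trans |S|+|B| (ℕ.+-comm (length S) _)) ⟩
          suc (length B +ℕ length S)           ≡⟨ ℕ.+-suc (length B) (length S) ⟨
          length B +ℕ suc (length S)
            ≤⟨ ℕ.+-mono-≤ (ℕ.≤-trans (|B|≤ b∈) (s≤s (ℕ.m≤n+m _ (count (adj M b) S)))) |S|<d ⟩
          suc (count (adj M b) S +ℕ count (adj M b) B) +ℕ d s ≡⟨ cong (λ m → suc m +ℕ d s) (d-split b) ⟨
          suc (d b +ℕ d s)                     ∎)

    -- Test vectors live on all of G; the deleted vertices are grouped with B and get the full
    -- weight.
    splitSX : allFin n ↭ S ++ (X ++ B)
    splitSX = ↭-trans splitX (↭-trans (Perm.++⁺ˡ X splitS) (Perm.shifts X S))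

    -- Degrees in S are below about c/2, so a weight ratio between 1/2 and 1 suits them. The ratio 2
    -- : 3 has deficit 1 per vertex, which exceeds 3 t once |S| > 3 t.
    |S|≤3t : length S ≤ 3 * t
    |S|≤3t = ℕ.≮⇒≥ λ 3t<|S| → let z , sub = lowDegreeTestVector G splitSX {c} {t} {2} {3} n≡ (ℕ.n≤1+n 2) lowdeg (few 3t<|S|) in spec z sub
      where
      lowdeg : ∀ {s} → s ∈ S → 3 * deg G s < c * 2
      lowdeg {s} s∈ = ℕ.*-cancelˡ-< 2 _ _ (begin-strict
        2 * (3 * deg G s)            ≤⟨ ℕ.*-monoʳ-≤ 2 (ℕ.*-monoʳ-≤ 3 (degG≤ s)) ⟩
        2 * (3 * (k +ℕ d s))
          ≡⟨ solve 2 (λ k d → con 2 :* (con 3 :* (k :+ d)) := con 6 :* k :+ con 3 :* (con 2 :* d)) refl k (d s) ⟩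
        6 * k +ℕ 3 * (2 * d s)        <⟨ ℕ.+-monoʳ-< (6 * k) (ℕ.*-monoʳ-< 3 (low s∈)) ⟩
        6 * k +ℕ 3 * N                ≤⟨ ℕ.+-monoʳ-≤ (6 * k) (ℕ.*-monoʳ-≤ 3 (ℕ.m≤n+m N (length X))) ⟩
        6 * k +ℕ 3 * (length X +ℕ N)   ≡⟨ cong (λ m → 6 * k +ℕ 3 * m) (trans |X|+N (sym n≡)) ⟩
        6 * k +ℕ 3 * (c +ℕ suc t)
          ≡⟨ solve 3 (λ k c t → con 6 :* k :+ con 3 :* (c :+ (con 1 :+ t)) := (con 6 :* k :+ con 3 :* t :+ con 3) :+ con 3 :* c) refl k c t ⟩
        (6 * k +ℕ 3 * t +ℕ 3) +ℕ 3 * c  ≤⟨ ℕ.+-monoˡ-≤ (3 * c) c≥₁ ⟩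
        c +ℕ 3 * c                    ≡⟨ solve 1 (λ c → c :+ con 3 :* c := con 2 :* (c :* con 2)) refl c ⟩
        2 * (c * 2)                  ∎)
      few : 3 * t < length S → length S * 2 +ℕ t * 3 < length S * 3
      few h = begin-strict
        length S * 2 +ℕ t * 3         ≡⟨ cong (length S * 2 +ℕ_) (ℕ.*-comm t 3) ⟩
        length S * 2 +ℕ 3 * t         <⟨ ℕ.+-monoʳ-< (length S * 2) h ⟩
        length S * 2 +ℕ length S      ≡⟨ solve 1 (λ s → s :* con 2 :+ s := s :* con 3) refl (length S) ⟩
        length S * 3                 ∎

    2|S|≤N : 2 * length S ≤ N
    2|S|≤N = ℕ.≤-trans (ℕ.*-monoʳ-≤ 2 |S|≤3t) (subst (_≤ N) (ℕ.*-assoc 2 3 t) 6t≤N)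

    -- Degrees in S are now bounded, so weight 1 suffices there. With p elsewhere, t + 1 such
    -- vertices are too many when (t + 1) (p - 1) > t p, and p = t + 2 is the least solution, since
    -- (t + 1)² = t (t + 2) + 1.
    |S|≤t : length S ≤ t
    |S|≤t = ℕ.≮⇒≥ λ t<|S| → let z , sub = lowDegreeTestVector G splitSX {c} {t} {1} {t +ℕ 2} n≡ (ℕ.m≤n⇒m≤o+n t (s≤s z≤n)) lowdeg (few t<|S|) in spec z sub
      where
      lowdeg : ∀ {s} → s ∈ S → (t +ℕ 2) * deg G s < c * 1
      lowdeg {s} s∈ = begin-strict
        (t +ℕ 2) * deg G s
          ≤⟨ ℕ.*-monoʳ-≤ (t +ℕ 2) (ℕ.≤-trans (degG≤ s) (ℕ.+-monoʳ-≤ k (ℕ.≤-trans (d≤|S| 2|S|≤N s∈) |S|≤3t))) ⟩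
        (t +ℕ 2) * (k +ℕ 3 * t)  <⟨ c≥₃ ⟩
        c                      ≡⟨ ℕ.*-identityʳ c ⟨
        c * 1                  ∎
      few : t < length S → length S * 1 +ℕ t * (t +ℕ 2) < length S * (t +ℕ 2)
      few h = begin-strict
        length S * 1 +ℕ t * (t +ℕ 2)       <⟨ ℕ.+-monoʳ-< (length S * 1) (ℕ.≤-refl {suc (t * (t +ℕ 2))}) ⟩
        length S * 1 +ℕ suc (t * (t +ℕ 2))
          ≡⟨ cong (length S * 1 +ℕ_) (solve 1 (λ t → con 1 :+ t :* (t :+ con 2) := (con 1 :+ t) :* (con 1 :+ t)) refl t) ⟩
        length S * 1 +ℕ suc t * suc t     ≤⟨ ℕ.+-monoʳ-≤ (length S * 1) (ℕ.*-monoˡ-≤ (suc t) h) ⟩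
        length S * 1 +ℕ length S * suc t
          ≡⟨ solve 2 (λ s t → s :* con 1 :+ s :* (con 1 :+ t) := s :* (t :+ con 2)) refl (length S) t ⟩
        length S * (t +ℕ 2)               ∎

    module NonEmpty {s₀ : Fin n} (s₀∈ : s₀ ∈ S) where

      d≤ : ∀ {s} → s ∈ S → d s ≤ length S
      d≤ = d≤|S| 2|S|≤N

      tight : ∀ {s} → s ∈ S → count (adj G s) X ≡ k × degIn G vs s ≡ t
      tight {s} s∈ = ≤-squeeze
        (ℕ.≤-trans (count≤length (adj G s) X) |X|≤k)
        (ℕ.≤-trans (degIn≤d s) (ℕ.≤-trans (d≤ s∈) |S|≤t))
        (subst₂ _≤_ (sym δ≡) (degG s) (minDeg s))

      |S|≡t : length S ≡ t
      |S|≡t = ℕ.≤-antisym |S|≤t (subst (_≤ length S) (proj₂ (tight s₀∈)) (ℕ.≤-trans (degIn≤d s₀) (d≤ s₀∈)))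

      d≡t : ∀ {s} → s ∈ S → d s ≡ t
      d≡t {s} s∈ = ℕ.≤-antisym (subst (d s ≤_) |S|≡t (d≤ s∈)) (subst (_≤ d s) (proj₂ (tight s∈)) (degIn≤d s))

      |X|≡k : length X ≡ k
      |X|≡k = ℕ.≤-antisym |X|≤k (subst (_≤ length X) (proj₁ (tight s₀∈)) (count≤length (adj G s₀) X))

      degS : ∀ {s} → s ∈ S → deg G s ≤ δ
      degS {s} s∈ = ℕ.≤-reflexive (trans (degG s)
        (trans (cong₂ _+ℕ_ (proj₁ (tight s∈)) (proj₂ (tight s∈))) (trans (ℕ.+-comm k t) δ≡)))

      S–X : ∀ {s x} → s ∈ S → x ∈ X → adj G s x ≡ true
      S–X {s} s∈ x∈ = ≢false⇒true λ e →
        ℕ.<-irrefl (trans (proj₁ (tight s∈)) (sym |X|≡k)) (count-miss (adj G s) X x∈ e)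

      -- By `tight` and `d≡t` a vertex of S has degree t within `vs` both before and after closing,
      -- so the closure added no edge at S and adjacencies found in M hold in G.
      M⇒G : ∀ {s v} → s ∈ S → v ∈ vs → adj M s v ≡ true → adj G s v ≡ true
      M⇒G {s} s∈ v∈ m = ≢false⇒true λ e →
        ℕ.<-irrefl (trans (proj₂ (tight s∈)) (sym (d≡t s∈))) (count-strict vs v∈ (λ _ → extends) e m)

      ¬M⇒¬G : ∀ {s v} → adj M s v ≡ false → adj G s v ≡ false
      ¬M⇒¬G e = ≢true⇒false λ g → true≢false (extends g) e

      -- One neighbour in S lifts d b from |B| - 1 to |B|. Together with d s′ = |S| this reaches N,
      -- and closedness joins b to s′ as well. So all vertices of S have the same neighbours in B.
      spread : ∀ {s s′ b} → s ∈ S → s′ ∈ S → b ∈ B → adj M s b ≡ true → adj M s′ b ≡ true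
      spread {s} {s′} {b} s∈ s′∈ b∈ sb = S~B s′∈ b∈ (begin
        N                       ≡⟨ trans |S|+|B| (ℕ.+-comm (length S) (length B)) ⟩
        length B +ℕ length S
          ≤⟨ ℕ.+-mono-≤ (ℕ.≤-trans (|B|≤ b∈) (ℕ.+-monoˡ-≤ (count (adj M b) B) (count-positive (adj M b) S s∈ (adj-sym M sb)))) (ℕ.≤-reflexive (trans |S|≡t (sym (d≡t s′∈)))) ⟩
        count (adj M b) S +ℕ count (adj M b) B +ℕ d s′ ≡⟨ cong (_+ℕ d s′) (d-split b) ⟨
        d b +ℕ d s′              ∎)

      attached? : (b : Fin n) → Dec (adj M s₀ b ≡ true)
      attached? b = adj M s₀ b ≟ᵇ true

      T R : List (Fin n)
      T = filter attached? B
      R = filter (¬? ∘ attached?) B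

      splitB : B ↭ T ++ R
      splitB = filter-split attached? B

      T⊆B : ∀ {b} → b ∈ T → b ∈ B
      T⊆B b∈ = proj₁ (∈-filter⁻ attached? b∈)

      R⊆B : ∀ {b} → b ∈ R → b ∈ B
      R⊆B b∈ = proj₁ (∈-filter⁻ (¬? ∘ attached?) {xs = B} b∈)

      S–T : ∀ {s b} → s ∈ S → b ∈ T → adj M s b ≡ true
      S–T s∈ b∈ = spread s₀∈ s∈ (T⊆B b∈) (proj₂ (∈-filter⁻ attached? {xs = B} b∈))

      S–R : ∀ {s b} → s ∈ S → b ∈ R → adj M s b ≡ false
      S–R s∈ b∈ = ≢true⇒false λ e → proj₂ (∈-filter⁻ (¬? ∘ attached?) {xs = B} b∈) (spread s∈ s₀∈ (R⊆B b∈) e)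

      inner : ∀ {s} → s ∈ S → count (adj M s) S +ℕ length T ≡ t
      inner {s} s∈ = begin-equality
        count (adj M s) S +ℕ length T
          ≡⟨ cong (count (adj M s) S +ℕ_) (ℕ.+-identityʳ (length T)) ⟨
        count (adj M s) S +ℕ (length T +ℕ 0)
          ≡⟨ cong (count (adj M s) S +ℕ_) (cong₂ _+ℕ_ (count-all (adj M s) T (S–T s∈)) (count-none (adj M s) R (S–R s∈))) ⟨
        count (adj M s) S +ℕ (count (adj M s) T +ℕ count (adj M s) R)
          ≡⟨ cong (count (adj M s) S +ℕ_) (trans (count-↭ (adj M s) splitB) (count-++ (adj M s) T R)) ⟨
        count (adj M s) S +ℕ count (adj M s) B                  ≡⟨ d-split s ⟨
        d s                                                    ≡⟨ d≡t s∈ ⟩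
        t                                                      ∎

      extremal : Shape G k δ S (X ++ T) → Extremal G t k δ
      extremal sh = record
        { S = S ; W = X ++ T ; R = R
        ; split = ↭-trans splitSX (Perm.++⁺ˡ S (↭-trans (Perm.++⁺ˡ X splitB) (↭-reflexive (sym (++-assoc X T R)))))
        ; |S|≡t = |S|≡t
        ; degS = degS
        ; S–W = S–W
        ; S–R = λ s∈ b∈ → ¬M⇒¬G (S–R s∈ b∈)
        ; shape = sh
        }
        where
        S–W : ∀ {s b} → s ∈ S → b ∈ X ++ T → adj G s b ≡ true
        S–W s∈ b∈ with ∈-++⁻ X b∈
        ... | inj₁ b∈X = S–X s∈ b∈X
        ... | inj₂ b∈T = M⇒G s∈ (B⊆vs (T⊆B b∈T)) (S–T s∈ b∈T)

      |W| : length (X ++ T) ≡ k +ℕ length T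
      |W| = trans (length-++ X) (cong (_+ℕ length T) |X|≡k)

      -- With one attachment, each vertex of S has its other t - 1 neighbours inside S, which are
      -- all that S offers.
      asClique : length T ≡ 1 → Shape G k δ S (X ++ T)
      asClique |T| = clique (trans |W| (cong (k +ℕ_) |T|)) λ {s} {s′} s∈ s′∈ s≢s′ →
        M⇒G s∈ (S⊆vs s′∈) (≢false⇒true λ e → ℕ.<-irrefl refl (begin-strict
          t                           ≡⟨ inner s∈ ⟨
          count (adj M s) S +ℕ length T ≡⟨ trans (cong (count (adj M s) S +ℕ_) |T|) (ℕ.+-comm _ 1) ⟩
          1 +ℕ count (adj M s) S       <⟨ count-miss₂ (adj M s) S s∈ s′∈ s≢s′ (loopless M s) e ⟩
          length S                    ≡⟨ |S|≡t ⟩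
          t                           ∎))

      asIndependent : t ≤ length T → Shape G k δ S (X ++ T)
      asIndependent t≤|T| = independent
        (trans |W| (trans (cong (k +ℕ_) (ℕ.≤-antisym (subst (length T ≤_) (inner s₀∈) (ℕ.m≤n+m _ _)) t≤|T|)) (trans (ℕ.+-comm k t) δ≡)))
        λ {s} {s′} s∈ s′∈ → ¬M⇒¬G (≢true⇒false λ e → ℕ.<-irrefl refl (begin-strict
          t                             ≤⟨ t≤|T| ⟩
          length T                      <⟨ ℕ.+-monoˡ-≤ (length T) (count-positive (adj M s) S s′∈ e) ⟩
          count (adj M s) S +ℕ length T  ≡⟨ inner s∈ ⟩
          t                             ∎))

      resolve : ∀ T′ → T′ ≡ T → HamCycle G vs ⊎ Extremal G t k δ
      -- Without attachments a vertex of S would need t neighbours among the other t - 1 vertices of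
      -- S.
      resolve [] eq = contradiction (inner s₀∈) (ℕ.<⇒≢ (begin-strict
        count (adj M s₀) S +ℕ length T
          ≡⟨ trans (cong (λ l → count (adj M s₀) S +ℕ length l) (sym eq)) (ℕ.+-identityʳ _) ⟩
        count (adj M s₀) S              <⟨ count-miss (adj M s₀) S s₀∈ (loopless M s₀) ⟩
        length S                        ≡⟨ |S|≡t ⟩
        t                               ∎))
      resolve (_ ∷ []) eq = inj₂ (extremal (asClique (cong length (sym eq))))
      resolve (τ ∷ v ∷ T″) eq with t ℕ.≤? length T
      ... | yes t≤|T| = inj₂ (extremal (asIndependent t≤|T|))
      ... | no t≰|T| = inj₁ (reflects (transport (absorb Fin._≟_ M S τ v T″ R
          (subst (λ l → Unique (S ++ l ++ R)) (sym eq) (Unique-↭ (Perm.++⁺ˡ S splitB) uniqSB))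
          (λ s∈ b∈ → S–T s∈ (subst (_ ∈_) eq b∈))
          (λ b∈ b′∈ → cliqueB (back b∈) (back b′∈))
          (λ s∈ → ℕ.≤-reflexive (trans |S|≡t (trans (sym (inner s∈)) (cong (λ l → _ +ℕ length l) (sym eq)))))
          (subst₂ _<_ (cong length (sym eq)) (sym |S|≡t) (ℕ.≰⇒> t≰|T|)))))
        where
        back : ∀ {b} → b ∈ (τ ∷ v ∷ T″) ++ R → b ∈ B
        back {b} b∈ = Perm.∈-resp-↭ (↭-sym splitB) (subst (λ l → b ∈ l ++ R) eq b∈)
        transport : HamCycle M (S ++ (τ ∷ v ∷ T″) ++ R) → HamCycle M vs
        transport (x , xs , y , p , e , r) = x , xs , y , p , e , ↭-trans r
          (↭-trans (↭-reflexive (cong (λ l → S ++ l ++ R) eq))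
            (↭-trans (Perm.++⁺ˡ S (↭-sym splitB)) (↭-sym splitS)))

    decide : HamCycle G vs ⊎ Extremal G t k δ
    decide = byS S refl
      where
      byS : ∀ S′ → S′ ≡ S → HamCycle G vs ⊎ Extremal G t k δ
      byS (s ∷ _) eq = NonEmpty.resolve (subst (s ∈_) eq (here refl)) _ refl
      byS [] eq = inj₁ (reflects (cliqueCycle M vs uniq (ℕ.<⇒≤ 3≤|vs|) (λ u∈ v∈ → cliqueB (vs⊆B u∈) (vs⊆B v∈))))
        where
        vs⊆B : ∀ {v} → v ∈ vs → v ∈ B
        vs⊆B {v} v∈ = subst (λ l → v ∈ l ++ B) (sym eq) (Perm.∈-resp-↭ splitS v∈)

  hamiltonianOrExtremal : HamCycle G vs ⊎ Extremal G t k δ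
  hamiltonianOrExtremal = FromClosure.decide (closure G uniq 3≤|vs|)

-- Bijections from lists of vertices

bijection : ∀ {A B : Set} (f : A → B) → (∀ {x y} → f x ≡ f y → x ≡ y) → (∀ y → ∃[ x ] f x ≡ y) → A ↔ B
bijection f inj surj = mk↔ₛ′ f (proj₁ ∘ surj) (proj₂ ∘ surj) (λ x → inj (proj₂ (surj (f x))))

lookup-injective : ∀ {V : Set} {xs : List V} → Unique xs → ∀ {i j} → lookup xs i ≡ lookup xs j → i ≡ j
lookup-injective {xs = _ ∷ _}  _        {zero}  {zero}  _  = refl
lookup-injective {xs = _ ∷ xs} (x∉ ∷ _) {zero}  {suc j} eq = contradiction eq (All.lookup x∉ (∈-lookup {xs = xs} j))
lookup-injective {xs = _ ∷ xs} (x∉ ∷ _) {suc i} {zero}  eq = contradiction (sym eq) (All.lookup x∉ (∈-lookup {xs = xs} i))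
lookup-injective {xs = _ ∷ _}  (_ ∷ u)  {suc i} {suc j} eq = cong suc (lookup-injective u eq)

length-filter : ∀ {V : Set} (p : V → Bool) xs → length (filter (λ v → p v ≟ᵇ true) xs) ≡ count p xs
length-filter p [] = refl
length-filter p (x ∷ xs) with p x
... | true  = cong suc (length-filter p xs)
... | false = length-filter p xs

∣tabulate∣ : ∀ {n} {V : Set} (p : V → Bool) (f : Fin n → V) →
  ∣ Vec.tabulate (p ∘ f) ∣ ≡ count p (List.tabulate f)
∣tabulate∣ {zero}  p f = refl
∣tabulate∣ {suc n} p f with p (f zero)
... | true  = cong suc (∣tabulate∣ p (f ∘ suc))
... | false = ∣tabulate∣ p (f ∘ suc)

-- A finite choice without excluded middle: Q does not depend on X, so one subset that yields Q
-- settles the matter, and otherwise the proofs of P are collected over all subsets.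
subset-choice : ∀ {n} {P : Subset n → Set} {Q : Set} → (∀ X → P X ⊎ Q) → (∀ X → P X) ⊎ Q
subset-choice {zero} h with h Vec.[]
... | inj₁ p = inj₁ λ { Vec.[] → p }
... | inj₂ q = inj₂ q
subset-choice {suc n} h with subset-choice (h ∘ (inside Vec.∷_)) | subset-choice (h ∘ (outside Vec.∷_))
... | inj₁ p | inj₁ q = inj₁ λ { (inside Vec.∷ X) → p X ; (outside Vec.∷ X) → q X }
... | inj₂ q | _      = inj₂ q
... | inj₁ _ | inj₂ q = inj₂ q

module _ {G : Graph V} where

  path-lookup : ∀ {x xs y} → Path G x xs y → ∀ i j → toℕ j ≡ suc (toℕ i) →
    adj G (lookup (x ∷ xs) i) (lookup (x ∷ xs) j) ≡ true
  path-lookup (step e p) zero    (suc zero) refl = e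
  path-lookup (step e p) (suc i) (suc j)    eq   = path-lookup p i j (ℕ.suc-injective eq)

  path-last : ∀ {x xs y} → Path G x xs y → ∀ i → toℕ i ≡ length xs → lookup (x ∷ xs) i ≡ y
  path-last stop       zero    _  = refl
  path-last (step _ p) (suc i) eq = path-last p i (ℕ.suc-injective eq)

  HamCycle⇒Hamiltonian : ∀ {P : V → Set} {vs} → (∀ {v} (p q : P v) → p ≡ q) → Unique vs →
    (∀ {v} → v ∈ vs → P v) → (∀ {v} → P v → v ∈ vs) → 3 ≤ length vs → HamCycle G vs → Hamiltonian (induced G P)
  HamCycle⇒Hamiltonian irr uniq vs⇒P P⇒vs 3≤ (x , [] , y , p , e , r)
    with s≤s () ← subst (3 ≤_) (sym (Perm.↭-length r)) 3≤
  HamCycle⇒Hamiltonian irr uniq vs⇒P P⇒vs 3≤ (x , _ ∷ [] , y , p , e , r)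
    with s≤s (s≤s ()) ← subst (3 ≤_) (sym (Perm.↭-length r)) 3≤
  -- Two known entries in `xs` make `length (x ∷ xs)` compute to `3 + length ys`, the index type
  -- that `Hamiltonian` asks for.
  HamCycle⇒Hamiltonian {P} irr uniq vs⇒P P⇒vs 3≤ (x , xs@(_ ∷ _ ∷ ys) , y , p , e , r) =
    length ys , bijection f f-inj f-surj , cyclic
    where
    f : Fin (length (x ∷ xs)) → Σ[ v ∈ V ] P v
    f i = lookup (x ∷ xs) i , vs⇒P (Perm.∈-resp-↭ r (∈-lookup {xs = x ∷ xs} i))
    f-inj : ∀ {i j} → f i ≡ f j → i ≡ j
    f-inj eq = lookup-injective (Unique-↭ (↭-sym r) uniq) (cong proj₁ eq)
    pair≡ : ∀ {u v} {p : P u} {q : P v} → u ≡ v → (u , p) ≡ (v , q)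
    pair≡ refl = cong (_ ,_) (irr _ _)
    f-surj : ∀ y → ∃[ i ] f i ≡ y
    f-surj (v , pv) = Any.index v∈ , pair≡ (sym (lookup-index v∈))
      where
      v∈ : v ∈ x ∷ xs
      v∈ = Perm.∈-resp-↭ (↭-sym r) (P⇒vs pv)
    toℕ-mod : ∀ m → toℕ (m mod length (x ∷ xs)) ≡ m ℕ.% length (x ∷ xs)
    toℕ-mod m = Fin.toℕ-fromℕ< _
    cyclic : ∀ i → adj G (lookup (x ∷ xs) i) (lookup (x ∷ xs) (suc (toℕ i) mod length (x ∷ xs))) ≡ true
    -- Below the last index the successor is not reduced and an edge of the path is needed; at the
    -- last index it wraps to 0 and the closing edge is needed.
    cyclic i with ℕ.m≤n⇒m<n∨m≡n (Fin.toℕ<n i)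
    ... | inj₁ lt = path-lookup p i _ (trans (toℕ-mod (suc (toℕ i))) (m<n⇒m%n≡m lt))
    ... | inj₂ eq = subst₂ (λ u v → adj G u v ≡ true)
      (sym (path-last p i (ℕ.suc-injective eq)))
      (cong (lookup (x ∷ xs)) (sym (Fin.toℕ-injective {j = zero}
        (trans (toℕ-mod (suc (toℕ i))) (trans (cong (ℕ._% length (x ∷ xs)) eq) (n%n≡0 (length (x ∷ xs))))))))
      e

-- Isomorphisms onto the two extremal graphs

module _ {n : ℕ} (G : Graph (Fin n)) {S W R : List (Fin n)} (split : allFin n ↭ S ++ (W ++ R))
  (complete : ∀ {u v} → u ∈ W ++ R → v ∈ W ++ R → u ≢ v → adj G u v ≡ true)
  (S–W : ∀ {s b} → s ∈ S → b ∈ W → adj G s b ≡ true)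
  (S–R : ∀ {s b} → s ∈ S → b ∈ R → adj G s b ≡ false) where

  private
    uniq : Unique (S ++ (W ++ R))
    uniq = Unique-↭ split (allFin⁺ n)

    uniqWR : Unique (W ++ R)
    uniqWR = Unique-++⁻ʳ S uniq

    Vertex : Set
    Vertex = Fin (length W) ⊎ Fin (length R) ⊎ Fin (length S)

    e : Vertex → Fin n
    e (inj₁ i)        = lookup W i
    e (inj₂ (inj₁ i)) = lookup R i
    e (inj₂ (inj₂ i)) = lookup S i

    W∈ : ∀ i → lookup W i ∈ W ++ R
    W∈ i = ∈-++⁺ˡ (∈-lookup {xs = W} i)

    R∈ : ∀ i → lookup R i ∈ W ++ R
    R∈ i = ∈-++⁺ʳ W (∈-lookup {xs = R} i)

    W≢R : ∀ i j → lookup W i ≢ lookup R j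
    W≢R i j = Unique-++-disjoint W uniqWR (∈-lookup {xs = W} i) (∈-lookup {xs = R} j)

    S≢WR : ∀ i {v} → v ∈ W ++ R → lookup S i ≢ v
    S≢WR i v∈ = Unique-++-disjoint S uniq (∈-lookup {xs = S} i) v∈

    e-inj : ∀ {x y} → e x ≡ e y → x ≡ y
    e-inj {inj₁ i}        {inj₁ j}        eq = cong inj₁ (lookup-injective (Unique-++⁻ˡ W uniqWR) eq)
    e-inj {inj₁ i}        {inj₂ (inj₁ j)} eq = contradiction eq (W≢R i j)
    e-inj {inj₁ i}        {inj₂ (inj₂ j)} eq = contradiction (sym eq) (S≢WR j (W∈ i))
    e-inj {inj₂ (inj₁ i)} {inj₁ j}        eq = contradiction (sym eq) (W≢R j i)
    e-inj {inj₂ (inj₁ i)} {inj₂ (inj₁ j)} eq = cong (inj₂ ∘ inj₁) (lookup-injective (Unique-++⁻ʳ W uniqWR) eq)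
    e-inj {inj₂ (inj₁ i)} {inj₂ (inj₂ j)} eq = contradiction (sym eq) (S≢WR j (R∈ i))
    e-inj {inj₂ (inj₂ i)} {inj₁ j}        eq = contradiction eq (S≢WR i (W∈ j))
    e-inj {inj₂ (inj₂ i)} {inj₂ (inj₁ j)} eq = contradiction eq (S≢WR i (R∈ j))
    e-inj {inj₂ (inj₂ i)} {inj₂ (inj₂ j)} eq = cong (inj₂ ∘ inj₂) (lookup-injective (Unique-++⁻ˡ S uniq) eq)

    e-surj : ∀ v → ∃[ x ] e x ≡ v
    e-surj v with ∈-++⁻ S (Perm.∈-resp-↭ split (∈-allFin v))
    ... | inj₁ v∈ = inj₂ (inj₂ (Any.index v∈)) , sym (lookup-index v∈)
    ... | inj₂ v∈ with ∈-++⁻ W v∈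
    ...   | inj₁ v∈W = inj₁ (Any.index v∈W) , sym (lookup-index v∈W)
    ...   | inj₂ v∈R = inj₂ (inj₁ (Any.index v∈R)) , sym (lookup-index v∈R)

  clique-lookup : ∀ {xs} → Unique xs → (∀ {u v} → u ∈ xs → v ∈ xs → u ≢ v → adj G u v ≡ true) →
    ∀ i j → adj G (lookup xs i) (lookup xs j) ≡ adj (K (length xs)) i j
  clique-lookup {xs} u h i j with i Fin.≟ j
  ... | yes refl = loopless G (lookup xs i)
  ... | no i≢j   = h (∈-lookup {xs = xs} i) (∈-lookup {xs = xs} j) (i≢j ∘ lookup-injective u)

  -- `Γ` is `I` for `H` and `K` for `L`. The sizes come with equations, so that matching on `refl`
  -- aligns the vertex types with the list lengths and no transport along them remains.
  join-≅ : (Γ : ∀ r → Graph (Fin r)) →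
    (∀ i j → adj G (lookup S i) (lookup S j) ≡ adj (Γ (length S)) i j) →
    ∀ {p q r} → length W ≡ p → length R ≡ q → length S ≡ r → G ≅ (K p ∨ (K q ∪ Γ r))
  join-≅ Γ S-S refl refl refl = mk↔ₛ′ (proj₁ ∘ e-surj) e (λ x → e-inj (proj₂ (e-surj (e x)))) (proj₂ ∘ e-surj) ,
    λ u v → trans (cong₂ (adj G) (sym (proj₂ (e-surj u))) (sym (proj₂ (e-surj v)))) (adj-e (proj₁ (e-surj u)) (proj₁ (e-surj v)))
    where
    adj-e : ∀ x y → adj G (e x) (e y) ≡ adj (K (length W) ∨ (K (length R) ∪ Γ (length S))) x y
    adj-e (inj₁ i) (inj₁ j) = clique-lookup (Unique-++⁻ˡ W uniqWR) (λ u∈ v∈ → complete (∈-++⁺ˡ u∈) (∈-++⁺ˡ v∈)) i j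
    adj-e (inj₁ i) (inj₂ (inj₁ j)) = complete (W∈ i) (R∈ j) (W≢R i j)
    adj-e (inj₁ i) (inj₂ (inj₂ j)) = adj-sym G (S–W (∈-lookup {xs = S} j) (∈-lookup {xs = W} i))
    adj-e (inj₂ (inj₁ i)) (inj₁ j) = complete (R∈ i) (W∈ j) (W≢R j i ∘ sym)
    adj-e (inj₂ (inj₂ i)) (inj₁ j) = S–W (∈-lookup {xs = S} i) (∈-lookup {xs = W} j)
    adj-e (inj₂ (inj₁ i)) (inj₂ (inj₁ j)) = clique-lookup (Unique-++⁻ʳ W uniqWR) (λ u∈ v∈ → complete (∈-++⁺ʳ W u∈) (∈-++⁺ʳ W v∈)) i j
    adj-e (inj₂ (inj₁ i)) (inj₂ (inj₂ j)) = trans (symmetric G _ _) (S–R (∈-lookup {xs = S} j) (∈-lookup {xs = R} i))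
    adj-e (inj₂ (inj₂ i)) (inj₂ (inj₁ j)) = S–R (∈-lookup {xs = S} i) (∈-lookup {xs = R} j)
    adj-e (inj₂ (inj₂ i)) (inj₂ (inj₂ j)) = S-S i j

extremal⇒≅ : ∀ {n} (G : Graph (Fin n)) {c t k δ} → c +ℕ suc t ≡ n → t +ℕ k ≡ δ → 1 ≤ t →
  δ * suc (δ * t) < c → (∀ z → ¬ TestVector G c z) → Extremal G t k δ → (G ≅ H n k δ) ⊎ (G ≅ L n k δ)
extremal⇒≅ {n} G {c} {t} {k} {δ} n≡ δ≡ 1≤t large spec E = byShape shape
  where
  open Extremal E
  open ℕ.≤-Reasoning
  open ℕ-Solver
  uniq : Unique (S ++ (W ++ R))
  uniq = Unique-↭ split (allFin⁺ n)
  k+1≤δ : k +ℕ 1 ≤ δ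
  k+1≤δ = subst (k +ℕ 1 ≤_) (trans (ℕ.+-comm k t) δ≡) (ℕ.+-monoʳ-≤ k 1≤t)
  |W|≤δ : Shape G k δ S W → length W ≤ δ
  |W|≤δ (independent eq _) = ℕ.≤-reflexive eq
  |W|≤δ (clique eq _)      = subst (_≤ δ) (sym eq) k+1≤δ
  inW : Fin n → Bool
  inW b = does (b ∈? W)
  count-inW : count inW (W ++ R) ≤ δ
  count-inW = begin
    count inW (W ++ R)          ≡⟨ count-++ inW W R ⟩
    count inW W +ℕ count inW R  ≡⟨ cong₂ _+ℕ_ (count-all inW W (λ b∈ → dec-true (_ ∈? W) b∈))
                                     (count-none inW R (λ b∈ → dec-false (_ ∈? W) λ b∈W →
                                       Unique-++-disjoint W (Unique-++⁻ʳ S uniq) b∈W b∈ refl)) ⟩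
    length W +ℕ 0               ≡⟨ ℕ.+-identityʳ (length W) ⟩
    length W                    ≤⟨ |W|≤δ shape ⟩
    δ                           ∎
  S–notW : ∀ {b s} → b ∈ W ++ R → s ∈ S → inW b ≡ false → adj G b s ≡ false
  S–notW {b} {s} b∈ s∈ eq with ∈-++⁻ W b∈
  ... | inj₁ b∈W = contradiction eq (true≢false (dec-true (b ∈? W) b∈W))
  ... | inj₂ b∈R = trans (symmetric G b s) (S–R s∈ b∈R)
  |S|+|WR| : length S +ℕ length (W ++ R) ≡ n
  |S|+|WR| = trans (sym (length-++ S)) (trans (sym (Perm.↭-length split)) (length-tabulate id))
  |WR| : length (W ++ R) ≡ suc c
  |WR| = ℕ.+-cancelˡ-≡ t _ _ (trans (cong (_+ℕ length (W ++ R)) (sym |S|≡t)) (trans |S|+|WR| (trans (sym n≡)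
    (solve 2 (λ c t → c :+ (con 1 :+ t) := t :+ (con 1 :+ c)) refl c t))))
  -- The attachments of S are the vertices of `W`, at most δ many in either shape because k + 1 ≤ δ,
  -- and `W ++ R` has c + 1 vertices; so a missing edge would yield a forbidden test vector.
  complete : ∀ {u v} → u ∈ W ++ R → v ∈ W ++ R → u ≢ v → adj G u v ≡ true
  complete u∈ v∈ u≢v = ≢false⇒true λ uv →
    let z , sub = missingEdgeTestVector G split inW 1≤t (ℕ.≤-trans 1≤t (subst (t ≤_) δ≡ (ℕ.m≤m+n t k)))
                    large |S|≡t |WR| degS count-inW S–notW u∈ v∈ u≢v uv
    in spec z sub
  sizes : length W +ℕ length R +ℕ t ≡ n
  sizes = begin-equality
    length W +ℕ length R +ℕ t     ≡⟨ ℕ.+-comm (length W +ℕ length R) t ⟩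
    t +ℕ (length W +ℕ length R)   ≡⟨ cong₂ _+ℕ_ (sym |S|≡t) (sym (length-++ W)) ⟩
    length S +ℕ length (W ++ R)   ≡⟨ |S|+|WR| ⟩
    n                             ∎
  |S|≡ : length S ≡ δ ∸ k
  |S|≡ = trans |S|≡t (trans (sym (ℕ.m+n∸n≡m t k)) (cong (_∸ k) δ≡))
  byShape : Shape G k δ S W → (G ≅ H n k δ) ⊎ (G ≅ L n k δ)
  byShape (independent |W| ind) = inj₁ (join-≅ G split complete S–W S–R I
    (λ i j → ind (∈-lookup {xs = S} i) (∈-lookup {xs = S} j)) |W| |R| |S|≡)
    where
    |R| : length R ≡ n +ℕ k ∸ 2 * δ
    |R| = begin-equality
      length R                            ≡⟨ ℕ.m+n∸n≡m (length R) (2 * δ) ⟨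
      length R +ℕ 2 * δ ∸ 2 * δ
        ≡⟨ cong (λ m → m ∸ 2 * δ) (solve 2 (λ r d → r :+ con 2 :* d := d :+ r :+ d) refl (length R) δ) ⟩
      δ +ℕ length R +ℕ δ ∸ 2 * δ          ≡⟨ cong₂ (λ w d → w +ℕ length R +ℕ d ∸ 2 * δ) |W| δ≡ ⟨
      length W +ℕ length R +ℕ (t +ℕ k) ∸ 2 * δ ≡⟨ cong (_∸ 2 * δ) (ℕ.+-assoc (length W +ℕ length R) t k) ⟨
      length W +ℕ length R +ℕ t +ℕ k ∸ 2 * δ ≡⟨ cong (λ m → m +ℕ k ∸ 2 * δ) sizes ⟩
      n +ℕ k ∸ 2 * δ                      ∎
  byShape (clique |W| cl) = inj₂ (join-≅ G split complete S–W S–R K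
    (clique-lookup G split complete S–W S–R (Unique-++⁻ˡ S uniq) cl) |W| |R| |S|≡)
    where
    |R| : length R ≡ n ∸ δ ∸ 1
    |R| = begin-equality
      length R                            ≡⟨ ℕ.m+n∸n≡m (length R) (δ +ℕ 1) ⟨
      length R +ℕ (δ +ℕ 1) ∸ (δ +ℕ 1)     ≡⟨ cong (λ d → length R +ℕ (d +ℕ 1) ∸ (δ +ℕ 1)) δ≡ ⟨
      length R +ℕ (t +ℕ k +ℕ 1) ∸ (δ +ℕ 1)
        ≡⟨ cong (_∸ (δ +ℕ 1)) (solve 3 (λ r t k → r :+ (t :+ k :+ con 1) := k :+ con 1 :+ r :+ t) refl (length R) t k) ⟩
      k +ℕ 1 +ℕ length R +ℕ t ∸ (δ +ℕ 1)  ≡⟨ cong (λ w → w +ℕ length R +ℕ t ∸ (δ +ℕ 1)) |W| ⟨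
      length W +ℕ length R +ℕ t ∸ (δ +ℕ 1) ≡⟨ cong (_∸ (δ +ℕ 1)) sizes ⟩
      n ∸ (δ +ℕ 1)                        ≡⟨ ℕ.∸-+-assoc n δ 1 ⟨
      n ∸ δ ∸ 1                           ∎

-- Explicit thresholds, and the passage from one deleted set to all

minDegree≤deg : ∀ {n} (G : Graph (Fin n)) v → minDegree G ≤ deg G v
minDegree≤deg {n} G v = subst (minDegree G ≤_) (∣tabulate∣ (adj G v) id)
  (All.lookup (min≤xs n (map (degree G) (allFin n))) (∈-map⁺ (degree G) (∈-allFin v)))

theorem2p5 : ∀ (k δ : ℕ) → k +ℕ 2 ≤ δ →
    ∃[ n₀ ] ∀ (n : ℕ) → n₀ ≤ n →
    ∀ (G : Graph (Fin n)) → δ ≤ minDegree G →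
    ∀ (ρ : ℝ) → IsSpectralRadius G ρ →
    fromℤ (+ n - + δ + + k - + 1) ≤ʳ ρ →
    (k -Hamiltonian G) ⊎ (G ≅ H n k δ) ⊎ (G ≅ L n k δ)
theorem2p5 k δ k+2≤δ = c₀ +ℕ suc t , λ n n₀≤n G δ≤ ρ (eigen , _) bound →
  let
    c = n ∸ suc t
    c₀≤c : c₀ ≤ c
    c₀≤c = ℕ.m+n≤o⇒m≤o∸n c₀ n₀≤n
    n≡ : c +ℕ suc t ≡ n
    n≡ = ℕ.m∸n+n≡m (ℕ.m+n≤o⇒n≤o c₀ n₀≤n)
    spec : ∀ z → ¬ TestVector G c z
    spec = noTestVector G {ρ} {c} eigen (subst (λ i → fromℤ i ≤ʳ ρ) (threshold n≡) bound)
  -- The alternative to a Hamilton cycle, an isomorphism of G with `H` or `L`, does not mention X,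
  -- so the analysis of single subsets can be merged.
  in subset-choice λ X → atSubset n G n≡ (λ v → ℕ.≤-trans δ≤ (minDegree≤deg G v)) spec c₀≤c X
  where
  t = δ ∸ k
  -- `a₁` admits the weights 2 and 3 and keeps at least three vertices outside X; `a₂` gives 6t ≤
  -- |vs|, so that S is at most half of it; `a₃` admits the weights 1 and t + 2; `a₄` admits the
  -- vector for a missing edge. The successors encode strict bounds, and the sum dominates each
  -- term.
  a₁ = 6 * k +ℕ 3 * t +ℕ 3
  a₂ = k +ℕ 6 * t
  a₃ = suc ((t +ℕ 2) * (k +ℕ 3 * t))
  a₄ = suc (δ * suc (δ * t))
  c₀ = a₁ +ℕ a₂ +ℕ a₃ +ℕ a₄
  δ≡ : t +ℕ k ≡ δ
  δ≡ = ℕ.m∸n+n≡m (ℕ.m+n≤o⇒m≤o k k+2≤δ)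
  1≤t : 1 ≤ t
  1≤t = ℕ.≤-trans (s≤s z≤n) (ℕ.m+n≤o⇒m≤o∸n 2 (subst (_≤ δ) (ℕ.+-comm k 2) k+2≤δ))
  threshold : ∀ {n c} → c +ℕ suc t ≡ n → + n - + δ + + k - + 1 ≡ + c
  threshold {c = c} refl = trans (cong (λ d → + (c +ℕ suc t) - + d + + k - + 1) (sym δ≡))
    (solve 3 (λ c t k → c :+ (con (+ 1) :+ t) :- (t :+ k) :+ k :- con (+ 1) := c) refl (+ c) (+ t) (+ k))
    where open ℤ-Solver
  module _ (n : ℕ) (G : Graph (Fin n)) {c : ℕ} (n≡ : c +ℕ suc t ≡ n) (minDeg : ∀ v → δ ≤ deg G v)
    (spec : ∀ z → ¬ TestVector G c z) (c₀≤c : c₀ ≤ c) (X : Subset n) where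
    a₁+a₂+a₃≤c : a₁ +ℕ a₂ +ℕ a₃ ≤ c
    a₁+a₂+a₃≤c = ℕ.m+n≤o⇒m≤o (a₁ +ℕ a₂ +ℕ a₃) c₀≤c
    a₁+a₂≤c : a₁ +ℕ a₂ ≤ c
    a₁+a₂≤c = ℕ.m+n≤o⇒m≤o (a₁ +ℕ a₂) a₁+a₂+a₃≤c
    ∈X? : ∀ v → Dec (Vec.lookup X v ≡ true)
    ∈X? v = Vec.lookup X v ≟ᵇ true
    Xs vs : List (Fin n)
    Xs = filter ∈X? (allFin n)
    vs = filter (¬? ∘ ∈X?) (allFin n)
    splitX : allFin n ↭ Xs ++ vs
    splitX = filter-split ∈X? (allFin n)
    |Xs| : length Xs ≡ ∣ X ∣
    |Xs| = trans (length-filter (Vec.lookup X) (allFin n))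
      (trans (sym (∣tabulate∣ (Vec.lookup X) id)) (cong ∣_∣ (Vec.tabulate∘lookup X)))
    atSubset : (∣ X ∣ ≤ k → Hamiltonian (induced G (_∉ˢ X))) ⊎ (G ≅ H n k δ) ⊎ (G ≅ L n k δ)
    atSubset with ∣ X ∣ ℕ.≤? k
    ... | no |X|≰k = inj₁ (λ |X|≤k → contradiction |X|≤k |X|≰k)
    ... | yes |X|≤k = conclude (hamiltonianOrExtremal G n≡ δ≡ minDeg spec c≥₁ c≥₂ c≥₃ {Xs} {vs} splitX |Xs|≤k)
      where
      |Xs|≤k : length Xs ≤ k
      |Xs|≤k = subst (_≤ k) (sym |Xs|) |X|≤k
      c≥₁ : a₁ ≤ c
      c≥₁ = ℕ.m+n≤o⇒m≤o a₁ a₁+a₂≤c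
      c≥₂ : a₂ ≤ c
      c≥₂ = ℕ.m+n≤o⇒n≤o a₁ a₁+a₂≤c
      c≥₃ : a₃ ≤ c
      c≥₃ = ℕ.m+n≤o⇒n≤o (a₁ +ℕ a₂) a₁+a₂+a₃≤c
      conclude : HamCycle G vs ⊎ Extremal G t k δ →
        (∣ X ∣ ≤ k → Hamiltonian (induced G (_∉ˢ X))) ⊎ (G ≅ H n k δ) ⊎ (G ≅ L n k δ)
      conclude (inj₁ ham) = inj₁ λ _ → HamCycle⇒Hamiltonian (λ _ _ → refl) (Unique-++⁻ʳ Xs (Unique-↭ splitX (allFin⁺ n)))
        (λ v∈ v∈X → proj₂ (∈-filter⁻ (¬? ∘ ∈X?) {xs = allFin n} v∈) (Vec.[]=⇒lookup v∈X))
        (λ {v} v∉X → ∈-filter⁺ (¬? ∘ ∈X?) (∈-allFin v) (λ eq → v∉X (Vec.lookup⇒[]= v X eq)))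
        (3≤|vs| G n≡ δ≡ minDeg spec c≥₁ c≥₂ c≥₃ {Xs} {vs} splitX |Xs|≤k) ham
      conclude (inj₂ E) = inj₂ (extremal⇒≅ G n≡ δ≡ 1≤t (ℕ.m+n≤o⇒n≤o (a₁ +ℕ a₂ +ℕ a₃) c₀≤c) spec E)
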